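{- Let $\mathbf{s}=(s_i)_{i\geq1}$ be a sequence of positive integers and $n\geq 1$. The following are equivalent: (i) the cone $\mathcal{C}_n^{(\mathbf{s})}$ is Gorenstein; (ii) there exists $m\in\mathcal{L}_n^{(\mathbf{s})}$ such that, as rational functions, $g^{(\mathbf{s})}(1/x_1,\ldots,1/x_n)=\pm x_1^{m_1}\cdots x_n^{m_n}\, g^{(\mathbf{s})}(x_1,\ldots,x_n)$; (iii) $f_n^{(\mathbf{s})}(q)=\sum_{\lambda\in\mathcal{L}_n^{(\mathbf{s})}} q^{|\lambda|}$ is self-reciprocal.
   Context: $\mathcal{L}_n^{(\mathbf{s})}=\{\lambda\in\mathbb{Z}^n : 0\leq \lambda_1/s_1\leq\cdots\leq \lambda_n/s_n\}$, $|\lambda|=\lambda_1+\cdots+\lambda_n$, and $g^{(\mathbf{s})}(x_1,\ldots,x_n)=\sum_{\lambda\in\mathcal{L}_n^{(\mathbf{s})}} x_1^{\lambda_1}\cdots x_n^{\lambda_n}$. The $\mathbf{s}$-lecture hall cone is $\mathcal{C}_n^{(\mathbf{s})}=\{\lambda\in\mathbb{R}^n: 0\leq \lambda_1/s_1\leq\cdots\leq\lambda_n/s_n\}$. A pointed rational cone $\mathcal{C}\subset\mathbb{R}^n$ is Gorenstein if there is an integer point $\mathbf{c}$ in the interior $\mathcal{C}^\circ$ with $\mathcal{C}^\circ\cap\mathbb{Z}^n=\mathbf{c}+(\mathcal{C}\cap\mathbb{Z}^n)$ ($\mathbf{c}$ is called a Gorenstein point). A rational function $r(q)$ is self-reciprocal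 if $r(1/q)=\pm q^k r(q)$ for some nonnegative integer $k$. -}

module Defs where

open import Data.Nat as ℕ using (ℕ; zero; suc)
import Data.Nat.Properties as ℕP
open import Data.Integer as ℤ using (ℤ; +_; 0ℤ; 1ℤ; -1ℤ; _*_; _+_; _-_; -_)
import Data.Integer.Properties as ℤP
open import Data.Fin using (Fin; zero; suc; toℕ; inject₁)
open import Data.Fin.Properties using (all?)
open import Data.Vec.Functional using () renaming (_∷_ to _∷v_)
open import Data.List using (List; []; _∷_; foldr; length; filter; map; concatMap; upTo)
open import Data.Product using (Σ; ∃; ∃-syntax; _×_; _,_)
open import Data.Sum using (_⊎_)
open import Relation.Binary.PropositionalEquality using (_≡_; _≢_)
open import Relation.Nullary using (Dec; yes; no; ¬_)
open import Relation.Unary using (Decidable)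

-- Lecture hall cone / lecture hall partitions.
-- s : ℕ → ℕ, with s i = s_i for i ≥ 1 (s 0 is unused).
-- A point λ ∈ ℤ^n is a function Fin n → ℤ; component i (0-based) is λ_{i+1}.

-- The i-th defining inequality of the cone, for a relation R (≤ or <):
--   i = 0     :  0 R λ_1            (i.e. 0 R λ_1/s_1)
--   i = j+1   :  λ_{j+1} s_{j+2} R λ_{j+2} s_{j+1}
--                (i.e. λ_{j+1}/s_{j+1} R λ_{j+2}/s_{j+2}, cleared of positive denominators)
Step : (ℤ → ℤ → Set) → (ℕ → ℕ) → {n : ℕ} → (Fin n → ℤ) → Fin n → Set
Step R s l zero    = R 0ℤ (l zero)
Step R s l (suc j) = R (l (inject₁ j) * + s (suc (suc (toℕ j))))
                       (l (suc j) * + s (suc (toℕ j)))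

step? : (R : ℤ → ℤ → Set) → (∀ a b → Dec (R a b)) →
        (s : ℕ → ℕ) → {n : ℕ} → (l : Fin n → ℤ) → (i : Fin n) → Dec (Step R s l i)
step? R R? s l zero    = R? 0ℤ (l zero)
step? R R? s l (suc j) = R? _ _

InL : (ℕ → ℕ) → (n : ℕ) → (Fin n → ℤ) → Set
InL s n l = ∀ i → Step ℤ._≤_ s l i

InL? : (s : ℕ → ℕ) → (n : ℕ) → (l : Fin n → ℤ) → Dec (InL s n l)
InL? s n l = all? (step? ℤ._≤_ ℤ._≤?_ s l)

-- λ ∈ interior of C_n^(s) (the cone is full-dimensional, cut out by the n
-- independent inequalities above, so its interior is given by the strict ones)
InInterior : (ℕ → ℕ) → (n : ℕ) → (Fin n → ℤ) → Set
InInterior s n l = ∀ i → Step ℤ._<_ s l i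

Gorenstein : (ℕ → ℕ) → ℕ → Set
Gorenstein s n =
  Σ (Fin n → ℤ) λ c →
    InInterior s n c ×
    (∀ (l : Fin n → ℤ) →
       (InInterior s n l → InL s n (λ i → l i - c i)) ×
       (InL s n (λ i → l i - c i) → InInterior s n l))

sumℤ : List ℤ → ℤ
sumℤ = foldr _+_ 0ℤ

ind : {P : Set} → Dec P → ℤ
ind (yes _) = 1ℤ
ind (no _)  = 0ℤ

PtEq? : {n : ℕ} {A : Set} → (∀ (a b : A) → Dec (a ≡ b)) →
        (u v : Fin n → A) → Dec (∀ i → u i ≡ v i)
PtEq? eq u v = all? (λ i → eq (u i) (v i))

PtLe? : {n : ℕ} → (u v : Fin n → ℕ) → Dec (∀ i → u i ℕ.≤ v i)
PtLe? u v = all? (λ i → u i ℕ.≤? v i)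

Sign : ℤ → Set
Sign ε = (ε ≡ 1ℤ) ⊎ (ε ≡ -1ℤ)

MPoly : ℕ → Set
MPoly n = List ((Fin n → ℕ) × ℤ)

mcoef : {n : ℕ} → MPoly n → (Fin n → ℕ) → ℤ
mcoef P a = sumℤ (map (λ { (b , c) → ind (PtEq? ℕP._≟_ b a) * c }) P)

MNonzero : {n : ℕ} → MPoly n → Set
MNonzero P = ∃[ a ] ¬ (mcoef P a ≡ 0ℤ)

toℤv : {n : ℕ} → (Fin n → ℕ) → (Fin n → ℤ)
toℤv a i = + a i

-- coefficient of x^a in g^(s)(x) = Σ_{λ ∈ L_n^(s)} x^λ
gcoef : (ℕ → ℕ) → (n : ℕ) → (Fin n → ℕ) → ℤ
gcoef s n a = ind (InL? s n (toℤv a))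

Qgcoef : (ℕ → ℕ) → (n : ℕ) → MPoly n → (Fin n → ℕ) → ℤ
Qgcoef s n Q a = sumℤ (map step Q)
  where
  step : (Fin n → ℕ) × ℤ → ℤ
  step (b , c) with PtLe? b a
  ... | yes _ = c * gcoef s n (λ i → a i ℕ.∸ b i)
  ... | no  _ = 0ℤ

-- g^(s) = P / Q as rational functions (Q ≠ 0 and Q·g = P as power series)
RepG : (ℕ → ℕ) → (n : ℕ) → MPoly n → MPoly n → Set
RepG s n P Q = MNonzero Q × (∀ a → Qgcoef s n Q a ≡ mcoef P a)

-- coefficient of x^e (e ∈ ℤ^n) in the Laurent polynomial  x^m · A(1/x) · B(x)
-- (i.e. sum over terms x^{m - α + β})
laurCoef : {n : ℕ} → (Fin n → ℤ) → MPoly n → MPoly n → (Fin n → ℤ) → ℤ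
laurCoef m A B e =
  sumℤ (map (λ { (α , c) → sumℤ (map (λ { (β , d) →
     ind (PtEq? ℤ._≟_ (λ i → m i - + α i + + β i) e) * (c * d) }) B) }) A)

zeroV : {n : ℕ} → Fin n → ℤ
zeroV _ = 0ℤ

-- (ii) ∃ m ∈ L_n^(s) with g(1/x) = ± x^m g(x) as rational functions.
-- Writing g = P/Q this is  P(1/x) Q(x) = ± x^m P(x) Q(1/x).
CondII : (ℕ → ℕ) → ℕ → Set
CondII s n =
  Σ (Fin n → ℤ) λ m → InL s n m ×
  Σ (MPoly n) λ P → Σ (MPoly n) λ Q → RepG s n P Q ×
  Σ ℤ λ ε → Sign ε ×
  (∀ e → laurCoef zeroV P Q e ≡ ε * laurCoef m Q P e)

comps : (n d : ℕ) → List (Fin n → ℕ)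
comps zero zero    = (λ ()) ∷ []
comps zero (suc d) = []
comps (suc n) d =
  concatMap (λ k → map (λ v → k ∷v v) (comps n (d ℕ.∸ k))) (upTo (suc d))

fcoef : (ℕ → ℕ) → (n : ℕ) → ℕ → ℤ
fcoef s n d = + length (filter (λ v → InL? s n (toℤv v)) (comps n d))

UPoly : Set
UPoly = List (ℕ × ℤ)

ucoef : UPoly → ℕ → ℤ
ucoef P a = sumℤ (map (λ { (b , c) → ind (b ℕP.≟ a) * c }) P)

UNonzero : UPoly → Set
UNonzero P = ∃[ a ] ¬ (ucoef P a ≡ 0ℤ)

Qfcoef : (ℕ → ℕ) → (n : ℕ) → UPoly → ℕ → ℤ
Qfcoef s n Q a = sumℤ (map step Q)
  where
  step : ℕ × ℤ → ℤ
  step (b , c) with b ℕ.≤? a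
  ... | yes _ = c * fcoef s n (a ℕ.∸ b)
  ... | no  _ = 0ℤ

RepF : (ℕ → ℕ) → (n : ℕ) → UPoly → UPoly → Set
RepF s n P Q = UNonzero Q × (∀ a → Qfcoef s n Q a ≡ ucoef P a)

-- coefficient of q^e in q^k · A(1/q) · B(q)
ulaurCoef : ℤ → UPoly → UPoly → ℤ → ℤ
ulaurCoef k A B e =
  sumℤ (map (λ { (α , c) → sumℤ (map (λ { (β , d) →
     ind ((k - + α + + β) ℤ.≟ e) * (c * d) }) B) }) A)

-- (iii) f_n^(s)(q) is self-reciprocal: f(1/q) = ± q^k f(q), k ∈ ℕ.
-- Writing f = P/Q this is  P(1/q) Q(q) = ± q^k P(q) Q(1/q).
CondIII : (ℕ → ℕ) → ℕ → Set
CondIII s n =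
  Σ UPoly λ P → Σ UPoly λ Q → RepF s n P Q ×
  Σ ℕ λ k → Σ ℤ λ ε → Sign ε ×
  (∀ e → ulaurCoef 0ℤ P Q e ≡ ε * ulaurCoef (+ k) Q P e)

{-# OPTIONS --safe #-}

-- The cone is cut out by the linear forms a_j(λ) = λ_j s_{j-1} − λ_{j-1} s_j (s_0 = 1, λ_0 = 0), and
-- a_j is the only one that does not vanish on the ray v_j = (0,…,0,s_j,…,s_n). Hence
-- Q₀ = ∏_j (1 − x^{v_j}) turns the indicator series g = ∏_j [0 ≤ a_j] into the indicator of the
-- half-open parallelepiped 0 ≤ a_j < a_j(v_j), a polynomial, and a comparison factor by factor
-- gives Q₀(1/x) g°(x) = (−1)ⁿ Q₀(1/x) g(1/x) for the series g° of the interior, where the right-hand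
-- side means the reflection of Q₀ g. So the functional equation g(1/x) = ± x^m g(x) holds for the
-- rational function g if and only if g° = ± x^m g as power series; the denominators are cancelled
-- using that a nonzero Laurent polynomial has a least exponent and acts injectively on series
-- with support bounded below. The last equation says that the cone is Gorenstein with Gorenstein
-- point m. Summing along the total degree gives the same equivalence for f, and f° = q^k f yields an
-- interior point c of degree k with c + L inside the interior and as many points in every degree,
-- hence equality.
module Submission where

open import Algebra.Bundles using (AbelianGroup)
import Algebra.Properties.AbelianGroup as AbelianGroupProperties
open import Algebra.Structures using (IsAbelianGroup)
open import Data.Empty using (⊥)
open import Data.Fin using (Fin; zero; suc; toℕ; inject₁)
open import Data.Integer as ℤ using (ℤ; +_; -[1+_]; 0ℤ; 1ℤ; -1ℤ; _+_; _*_; -_; _-_)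
open import Data.Integer using () renaming (-_ to neg; +_ to pos)
import Data.Integer.Properties as ℤP
open import Data.Integer.Tactic.RingSolver using (solve-∀)
open import Data.List using (List; []; _∷_; map; _++_; concatMap; upTo; filter; length)
open import Data.List.Membership.Propositional using (_∈_)
import Data.List.Properties as ListP
open import Data.List.Relation.Unary.All as All using (All; []; _∷_)
import Data.List.Relation.Unary.All.Properties as AllP
open import Data.List.Relation.Unary.Any using (here; there)
open import Data.Nat as ℕ using (ℕ; zero; suc; _≤_; _<_; s≤s; z≤n)
import Data.Nat.Properties as ℕP
open import Data.Product using (Σ; ∃; _×_; _,_; proj₁; proj₂; map₁; map₂)
open import Data.Sum using (_⊎_; inj₁; inj₂)
open import Data.Unit using (⊤; tt)
open import Data.Vec as Vec using (Vec; []; _∷_; zipWith; replicate; tabulate; lookup)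
open import Data.Vec.Functional using () renaming (_∷_ to _∷v_)
import Data.Vec.Properties as VecP
open import Data.Vec.Relation.Binary.Pointwise.Inductive using (Pointwise; []; _∷_)
open import Defs
open import Function using (_∘_)
open import Function.Bundles using (_⇔_; mk⇔)
open import Relation.Binary using (DecidableEquality; Trichotomous; tri<; tri≈; tri>; Transitive)
open import Relation.Binary.PropositionalEquality
open import Relation.Nullary using (¬_; Dec; yes; no; contradiction)
open import Relation.Nullary.Decidable using (decidable-stable)

-- The expansion of g(1/x) lives in the opposite orthant, so it shares no ring of series with `g°`.
-- Both are therefore placed in the module of bi-infinite series, on which Laurent polynomials still
-- act. Cancellation fails there: 1 - x annihilates the sum of all integer powers of x. Hence a
-- reflected series is always kept under a polynomial factor, and factors are cancelled only once
-- both sides are bounded below.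
--
-- Conditions (ii) and (iii) come with an arbitrary fraction P/Q, unrelated to Q₀. The converse
-- directions therefore multiply by Q, Q(1/x) and Q₀(1/x) at once: the first two serve the
-- functional equation, the last one reciprocity.
--
-- Only reciprocity is specific to the cone. It is computed for g, where the inequalities separate
-- into factors; f inherits it.

module ℤG = AbelianGroupProperties ℤP.+-0-abelianGroup

-- Finite sums and indicators

ind-yes : {P : Set} (P? : Dec P) → P → ind P? ≡ 1ℤ
ind-yes (yes _) _ = refl
ind-yes (no ¬p) p = contradiction p ¬p

ind-no : {P : Set} (P? : Dec P) → ¬ P → ind P? ≡ 0ℤ
ind-no (yes p) ¬p = contradiction p ¬p
ind-no (no _)  _  = refl

ind-cong : {P Q : Set} (P? : Dec P) (Q? : Dec Q) → (P → Q) → (Q → P) → ind P? ≡ ind Q?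
ind-cong P? (yes q) _ g = ind-yes P? (g q)
ind-cong P? (no ¬q) f _ = ind-no P? (¬q ∘ f)

+-congˡ : ∀ x {y z} → y ≡ z → x + y ≡ x + z
+-congˡ x = cong (λ y → x + y)

module _ {A : Set} where

  ∑ : List A → (A → ℤ) → ℤ
  ∑ xs f = sumℤ (map f xs)

  ∑-cong : {f g : A → ℤ} (xs : List A) → (∀ x → f x ≡ g x) → ∑ xs f ≡ ∑ xs g
  ∑-cong xs f≗g = cong sumℤ (ListP.map-cong f≗g xs)

  ∑-zero : {f : A → ℤ} {xs : List A} → All (λ x → f x ≡ 0ℤ) xs → ∑ xs f ≡ 0ℤ
  ∑-zero []       = refl
  ∑-zero (p ∷ ps) = cong₂ _+_ p (∑-zero ps)

  ∑-zero′ : {f : A → ℤ} (xs : List A) → (∀ x → f x ≡ 0ℤ) → ∑ xs f ≡ 0ℤ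
  ∑-zero′ xs p = ∑-zero (All.universal p xs)

  ∑-distrib-+ : (f g : A → ℤ) (xs : List A) → ∑ xs (λ x → f x + g x) ≡ ∑ xs f + ∑ xs g
  ∑-distrib-+ f g []       = refl
  ∑-distrib-+ f g (x ∷ xs) rewrite ∑-distrib-+ f g xs = interchange (f x) (g x) (∑ xs f) (∑ xs g)
    where
    interchange : ∀ a b c d → a + b + (c + d) ≡ a + c + (b + d)
    interchange = solve-∀

  *-distribˡ-∑ : (c : ℤ) (f : A → ℤ) (xs : List A) → ∑ xs (λ x → c * f x) ≡ c * ∑ xs f
  *-distribˡ-∑ c f []       = sym (ℤP.*-zeroʳ c)
  *-distribˡ-∑ c f (x ∷ xs) =
    trans (+-congˡ (c * f x) (*-distribˡ-∑ c f xs)) (sym (ℤP.*-distribˡ-+ c (f x) (∑ xs f)))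

  ∑-++ : (f : A → ℤ) (xs ys : List A) → ∑ (xs ++ ys) f ≡ ∑ xs f + ∑ ys f
  ∑-++ f []       ys = sym (ℤP.+-identityˡ _)
  ∑-++ f (x ∷ xs) ys = trans (+-congˡ (f x) (∑-++ f xs ys)) (sym (ℤP.+-assoc (f x) _ _))

∑-map : {A B : Set} (f : B → ℤ) (g : A → B) (xs : List A) → ∑ (map g xs) f ≡ ∑ xs (f ∘ g)
∑-map f g xs = cong sumℤ (sym (ListP.map-∘ xs))

∑-concatMap : {A B : Set} (f : B → ℤ) (g : A → List B) (xs : List A) →
  ∑ (concatMap g xs) f ≡ ∑ xs (λ x → ∑ (g x) f)
∑-concatMap f g []       = refl
∑-concatMap f g (x ∷ xs) =
  trans (∑-++ f (g x) (concatMap g xs)) (+-congˡ (∑ (g x) f) (∑-concatMap f g xs))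

∑-comm : {A B : Set} (f : A → B → ℤ) (xs : List A) (ys : List B) →
  ∑ xs (λ x → ∑ ys (f x)) ≡ ∑ ys (λ y → ∑ xs (λ x → f x y))
∑-comm f []       ys = sym (∑-zero′ ys (λ _ → refl))
∑-comm f (x ∷ xs) ys =
  trans (+-congˡ (∑ ys (f x)) (∑-comm f xs ys)) (sym (∑-distrib-+ (f x) _ ys))

-- Laurent polynomials acting on formal series

-- One interface for ℤ and ℤⁿ, so that f and g share the argument. Two relations are kept apart:
-- `_≺_` is total and supplies least exponents, `_≼_` expresses boundedness below. In ℤⁿ they must
-- differ, since the lexicographic order has infinite descending chains above a given element, but
-- none inside an orthant.
record OrderedExponents : Set₁ where
  infixl 6 _⊕_
  infix  4 _≺_ _≼_
  field
    E                 : Set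
    _⊕_               : E → E → E
    𝟘                 : E
    ⊖_                : E → E
    isAbelianGroup    : IsAbelianGroup _≡_ _⊕_ 𝟘 ⊖_
    _≟_               : DecidableEquality E
    _≺_               : E → E → Set
    ≺-cmp             : Trichotomous _≡_ _≺_
    ≺-trans           : Transitive _≺_
    ⊕-monoˡ-≺         : ∀ e {a b} → a ≺ b → a ⊕ e ≺ b ⊕ e
    _≼_               : E → E → Set
    ≼-translate       : ∀ m a {e} → m ≼ e ⊕ ⊖ a → m ⊕ a ≼ e
    _⊓_               : E → E → E
    ⊓-lowerˡ          : ∀ a b {e} → a ≼ e → a ⊓ b ≼ e
    ⊓-lowerʳ          : ∀ a b {e} → b ≼ e → a ⊓ b ≼ e
    -- Well-foundedness of ≺ on the set of all e with m ≼ e.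
    bounded-induction : ∀ m (P : E → Set) → (∀ e → ¬ (m ≼ e) → P e) →
                        (∀ e → (∀ e′ → e′ ≺ e → P e′) → P e) → ∀ e → P e

module Laurent (X : OrderedExponents) where
  open OrderedExponents X public

  abelianGroup : AbelianGroup _ _
  abelianGroup = record { isAbelianGroup = isAbelianGroup }

  open AbelianGroupProperties abelianGroup
  private module G = AbelianGroup abelianGroup

  infixl 6 _⊝_
  _⊝_ : E → E → E
  a ⊝ b = a ⊕ ⊖ b

  ⊝-comm : ∀ e a b → e ⊝ a ⊝ b ≡ e ⊝ b ⊝ a
  ⊝-comm e a b = trans (G.assoc e _ _) (trans (cong (e ⊕_) (G.comm _ _)) (sym (G.assoc e _ _)))

  ⊖-⊝ : ∀ e a → ⊖ (⊖ e ⊝ a) ≡ e ⊝ ⊖ a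
  ⊖-⊝ e a = trans (sym (⁻¹-∙-comm (⊖ e) (⊖ a))) (cong (_⊝ ⊖ a) (⁻¹-involutive e))

  ⊕-⊝ : ∀ e a → e ⊕ a ⊝ a ≡ e
  ⊕-⊝ e a = //-rightDividesʳ a e

  ⊝-⊕ : ∀ e a → e ⊝ a ⊕ a ≡ e
  ⊝-⊕ e a = //-rightDividesˡ a e

  ⊝≡𝟘⇒≡ : ∀ {a b} → 𝟘 ≡ a ⊝ b → a ≡ b
  ⊝≡𝟘⇒≡ eq = x∙y⁻¹≈ε⇒x≈y _ _ (sym eq)

  ≡⇒⊝≡𝟘 : ∀ {a b} → a ≡ b → 𝟘 ≡ a ⊝ b
  ≡⇒⊝≡𝟘 eq = sym (x≈y⇒x∙y⁻¹≈ε eq)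

  Poly : Set
  Poly = List (E × ℤ)

  -- Bi-infinite formal series Σ_e H(e) x^e, a module over Laurent polynomials.
  Series : Set
  Series = E → ℤ

  infixr 7 _·_
  _·_ : Poly → Series → Series
  (A · H) e = ∑ A (λ { (a , c) → c * H (e ⊝ a) })

  -- The constant series 1. `A · δ` is the coefficient function of `A` with repeated exponents
  -- merged, so equality of polynomials is tested on `δ`.
  δ : Series
  δ e = ind (𝟘 ≟ e)

  inv : Poly → Poly
  inv = map (map₁ ⊖_)

  mono : ℤ → E → Poly
  mono c a = (a , c) ∷ []

  -- The coefficients of x^m A(1/x) B(x), summed in the order of `laurCoef` and `ulaurCoef` so that
  -- these match term by term.
  laur : E → Poly → Poly → E → ℤ
  laur m A B e = ∑ A (λ { (α , c) → ∑ B (λ { (β , d) → ind (((m ⊝ α) ⊕ β) ≟ e) * (c * d) }) })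

  ·-cong : ∀ A {H K : Series} → (∀ e → H e ≡ K e) → ∀ e → (A · H) e ≡ (A · K) e
  ·-cong A H≗K e = ∑-cong A (λ { (a , c) → cong (c *_) (H≗K _) })

  ·-comm : ∀ A B H e → (A · B · H) e ≡ (B · A · H) e
  ·-comm A B H e = begin
    ∑ A (λ { (a , c) → c * ∑ B (λ { (b , d) → d * H (e ⊝ a ⊝ b) }) })
      ≡⟨ ∑-cong A (λ { (a , c) → sym (*-distribˡ-∑ c _ B) }) ⟩
    ∑ A (λ { (a , c) → ∑ B (λ x → c * (proj₂ x * H (e ⊝ a ⊝ proj₁ x))) })
      ≡⟨ ∑-comm (λ y x → proj₂ y * (proj₂ x * H (e ⊝ proj₁ y ⊝ proj₁ x))) A B ⟩
    ∑ B (λ x → ∑ A (λ y → proj₂ y * (proj₂ x * H (e ⊝ proj₁ y ⊝ proj₁ x))))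
      ≡⟨ ∑-cong B (λ { (b , d) → trans (∑-cong A (λ { (a , c) → swap a c b d })) (*-distribˡ-∑ d _ A) }) ⟩
    ∑ B (λ { (b , d) → d * ∑ A (λ { (a , c) → c * H (e ⊝ b ⊝ a) }) }) ∎
    where
    open ≡-Reasoning
    exchange : ∀ x y z → x * (y * z) ≡ y * (x * z)
    exchange = solve-∀
    swap : ∀ a c b d → c * (d * H (e ⊝ a ⊝ b)) ≡ d * (c * H (e ⊝ b ⊝ a))
    swap a c b d = trans (cong (λ z → c * (d * H z)) (⊝-comm e a b)) (exchange c d _)

  inv-· : ∀ A H e → (inv A · H) e ≡ (A · (H ∘ ⊖_)) (⊖ e)
  inv-· A H e = trans (∑-map _ (map₁ ⊖_) A) (∑-cong A (λ { (a , c) → cong (λ z → c * H z) (sym (⊖-⊝ e a)) }))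

  mono-· : ∀ c a H e → (mono c a · H) e ≡ c * H (e ⊝ a)
  mono-· c a H e = ℤP.+-identityʳ _

  mono-1-· : ∀ a H e → (mono 1ℤ a · H) e ≡ H (e ⊝ a)
  mono-1-· a H e = trans (mono-· 1ℤ a H e) (ℤP.*-identityˡ _)

  ·-*ˡ : ∀ A k H e → (A · (λ x → k * H x)) e ≡ k * (A · H) e
  ·-*ˡ A k H e = trans (∑-cong A (λ { (a , c) → exchange c k _ })) (*-distribˡ-∑ k _ A)
    where
    exchange : ∀ x y z → x * (y * z) ≡ y * (x * z)
    exchange = solve-∀

  ·-+ : ∀ A H K e → (A · (λ x → H x + K x)) e ≡ (A · H) e + (A · K) e
  ·-+ A H K e = trans (∑-cong A (λ { (a , c) → ℤP.*-distribˡ-+ c _ _ })) (∑-distrib-+ _ _ A)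

  laur-· : ∀ m A B e → laur m A B e ≡ (inv A · mono 1ℤ m · B · δ) e
  laur-· m A B e = begin
    ∑ A (λ { (α , c) → ∑ B (λ { (β , d) → ind (((m ⊝ α) ⊕ β) ≟ e) * (c * d) }) })
      ≡⟨ ∑-cong A (λ { (α , c) → trans (∑-cong B (λ { (β , d) →
           trans (rearrange (ind (((m ⊝ α) ⊕ β) ≟ e)) c d)
             (cong (λ z → c * (d * z)) (ind-cong (((m ⊝ α) ⊕ β) ≟ e) (𝟘 ≟ (e ⊝ ⊖ α ⊝ m ⊝ β)) (to α β) (from α β))) }))
           (*-distribˡ-∑ c _ B) }) ⟩
    ∑ A (λ { (α , c) → c * (B · δ) (e ⊝ ⊖ α ⊝ m) })
      ≡⟨ ∑-cong A (λ { (α , c) → cong (c *_) (sym (mono-1-· m (B · δ) _)) }) ⟩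
    ∑ A (λ { (α , c) → c * (mono 1ℤ m · B · δ) (e ⊝ ⊖ α) })
      ≡⟨ ∑-map _ (map₁ ⊖_) A ⟨
    (inv A · mono 1ℤ m · B · δ) e ∎
    where
    open ≡-Reasoning
    rearrange : ∀ i c d → i * (c * d) ≡ c * (d * i)
    rearrange = solve-∀
    to : ∀ α β → (m ⊝ α) ⊕ β ≡ e → 𝟘 ≡ e ⊝ ⊖ α ⊝ m ⊝ β
    to α β refl = ≡⇒⊝≡𝟘 (begin
      (m ⊝ α) ⊕ β ⊝ ⊖ α ⊝ m   ≡⟨ cong (λ z → (m ⊝ α) ⊕ β ⊕ z ⊝ m) (⁻¹-involutive α) ⟩
      (m ⊝ α) ⊕ β ⊕ α ⊝ m     ≡⟨ cong (_⊝ m) (trans (G.assoc _ β α) (trans (cong ((m ⊝ α) ⊕_) (G.comm β α)) (sym (G.assoc _ α β)))) ⟩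
      (m ⊝ α) ⊕ α ⊕ β ⊝ m     ≡⟨ cong (λ z → z ⊕ β ⊝ m) (⊝-⊕ m α) ⟩
      m ⊕ β ⊝ m               ≡⟨ xyx⁻¹≈y m β ⟩
      β                       ∎)
    from : ∀ α β → 𝟘 ≡ e ⊝ ⊖ α ⊝ m ⊝ β → (m ⊝ α) ⊕ β ≡ e
    from α β eq = begin
      (m ⊝ α) ⊕ β                    ≡⟨ cong ((m ⊝ α) ⊕_) (⊝≡𝟘⇒≡ eq) ⟨
      (m ⊝ α) ⊕ (e ⊝ ⊖ α ⊝ m)        ≡⟨ cong₂ _⊕_ (G.comm m (⊖ α)) (cong (_⊝ m) (cong (e ⊕_) (⁻¹-involutive α))) ⟩
      (⊖ α ⊕ m) ⊕ ((e ⊕ α) ⊝ m)      ≡⟨ G.comm _ _ ⟩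
      ((e ⊕ α) ⊝ m) ⊕ (⊖ α ⊕ m)      ≡⟨ cong (((e ⊕ α) ⊝ m) ⊕_) (G.comm _ _) ⟩
      ((e ⊕ α) ⊝ m) ⊕ (m ⊕ ⊖ α)      ≡⟨ G.assoc _ m (⊖ α) ⟨
      ((e ⊕ α) ⊝ m) ⊕ m ⊝ α          ≡⟨ cong (_⊝ α) (⊝-⊕ (e ⊕ α) m) ⟩
      e ⊕ α ⊝ α                      ≡⟨ ⊕-⊝ e α ⟩
      e                              ∎

  -- Normal forms of Laurent polynomials

  data Sorted : Poly → Set where
    []  : Sorted []
    _∷_ : ∀ {a c A} → All ((a ≺_) ∘ proj₁) A → Sorted A → Sorted ((a , c) ∷ A)

  insert : E × ℤ → Poly → Poly
  insert (b , d) [] = (b , d) ∷ []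
  insert (b , d) ((a , c) ∷ A) with ≺-cmp b a
  ... | tri< _ _ _ = (b , d) ∷ (a , c) ∷ A
  ... | tri≈ _ _ _ = (a , d + c) ∷ A
  ... | tri> _ _ _ = (a , c) ∷ insert (b , d) A

  insert-All : ∀ {P : E → Set} b d A → P b → All (P ∘ proj₁) A → All (P ∘ proj₁) (insert (b , d) A)
  insert-All b d [] pb [] = pb ∷ []
  insert-All b d ((a , c) ∷ A) pb (pa ∷ pA) with ≺-cmp b a
  ... | tri< _ _ _ = pb ∷ pa ∷ pA
  ... | tri≈ _ _ _ = pa ∷ pA
  ... | tri> _ _ _ = pa ∷ insert-All b d A pb pA

  insert-Sorted : ∀ x {A} → Sorted A → Sorted (insert x A)
  insert-Sorted (b , d) [] = [] ∷ []
  insert-Sorted (b , d) {(a , c) ∷ A} (a<A ∷ sA) with ≺-cmp b a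
  ... | tri< b<a _ _ = (b<a ∷ All.map (≺-trans b<a) a<A) ∷ a<A ∷ sA
  ... | tri≈ _ _ _   = a<A ∷ sA
  ... | tri> _ _ a<b = insert-All b d A a<b a<A ∷ insert-Sorted (b , d) sA

  insert-· : ∀ b d A H e → (insert (b , d) A · H) e ≡ d * H (e ⊝ b) + (A · H) e
  insert-· b d [] H e = refl
  insert-· b d ((a , c) ∷ A) H e with ≺-cmp b a
  ... | tri< _ _ _    = refl
  ... | tri≈ _ refl _ = distrib d c _ _
    where
    distrib : ∀ d c h r → (d + c) * h + r ≡ d * h + (c * h + r)
    distrib = solve-∀
  ... | tri> _ _ _    = trans (+-congˡ (c * H (e ⊝ a)) (insert-· b d A H e)) (exchange (c * H (e ⊝ a)) (d * H (e ⊝ b)) ((A · H) e))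
    where
    exchange : ∀ x y z → x + (y + z) ≡ y + (x + z)
    exchange = solve-∀

  -- Merging equal exponents makes the head the strictly least one, so that its coefficient can be
  -- read off. Merged coefficients may be zero, which is why later inductions split on the head
  -- coefficient.
  sort : Poly → Poly
  sort []      = []
  sort (x ∷ A) = insert x (sort A)

  sort-Sorted : ∀ A → Sorted (sort A)
  sort-Sorted []      = []
  sort-Sorted (x ∷ A) = insert-Sorted x (sort-Sorted A)

  sort-· : ∀ A H e → (sort A · H) e ≡ (A · H) e
  sort-· []            H e = refl
  sort-· ((a , c) ∷ A) H e = trans (insert-· a c (sort A) H e) (+-congˡ (c * H (e ⊝ a)) (sort-· A H e))

  ≺⇒≢ : ∀ {a b} → a ≺ b → a ≢ b
  ≺⇒≢ {a} {b} a<b a≡b with ≺-cmp a b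
  ... | tri< _ a≢b _ = a≢b a≡b
  ... | tri≈ a≮b _ _ = a≮b a<b
  ... | tri> _ a≢b _ = a≢b a≡b

  head-coeff : ∀ {a c A} → All ((a ≺_) ∘ proj₁) A → (((a , c) ∷ A) · δ) a ≡ c
  head-coeff {a} {c} a<A = trans
    (cong₂ _+_ (trans (cong (c *_) (ind-yes (𝟘 ≟ (a ⊝ a)) (≡⇒⊝≡𝟘 refl))) (ℤP.*-identityʳ c))
      (∑-zero (All.map (λ { {b , d} a<b → trans
        (cong (d *_) (ind-no (𝟘 ≟ (a ⊝ b)) (≺⇒≢ a<b ∘ ⊝≡𝟘⇒≡))) (ℤP.*-zeroʳ d) }) a<A)))
    (ℤP.+-identityʳ c)

  drop-zero : ∀ a A H e → (((a , 0ℤ) ∷ A) · H) e ≡ (A · H) e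
  drop-zero a A H e = ℤP.+-identityˡ _

  -- `head-coeff` forces the leading coefficient to vanish; the tail then satisfies the same
  -- hypothesis.
  sorted-zero : ∀ {A} → Sorted A → (∀ e → (A · δ) e ≡ 0ℤ) → ∀ H e → (A · H) e ≡ 0ℤ
  sorted-zero [] _ H e = refl
  sorted-zero {(a , c) ∷ A} (a<A ∷ sA) Aδ≡0 H e with trans (sym (head-coeff {c = c} a<A)) (Aδ≡0 a)
  ... | refl = trans (drop-zero a A H e)
                 (sorted-zero sA (λ e → trans (sym (drop-zero a A δ e)) (Aδ≡0 e)) H e)

  poly-zero : ∀ A → (∀ e → (A · δ) e ≡ 0ℤ) → ∀ H e → (A · H) e ≡ 0ℤ
  poly-zero A Aδ≡0 H e = trans (sym (sort-· A H e))
    (sorted-zero (sort-Sorted A) (λ e → trans (sort-· A δ e) (Aδ≡0 e)) H e)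

  infixr 7 _⊛_
  _⊛_ : Poly → Poly → Poly
  A ⊛ B = concatMap (λ { (a , c) → map (λ { (b , d) → a ⊕ b , c * d }) B }) A

  ⊛-· : ∀ A B H e → ((A ⊛ B) · H) e ≡ (A · B · H) e
  ⊛-· A B H e = trans (∑-concatMap _ _ A) (∑-cong A λ { (a , c) → trans (∑-map _ _ B)
    (trans (∑-cong B λ { (b , d) → trans (cong (λ z → c * d * H z) (⊝-⊕-assoc a b)) (ℤP.*-assoc c d _) })
      (*-distribˡ-∑ c (λ { (b , d) → d * H (e ⊝ a ⊝ b) }) B)) })
    where
    ⊝-⊕-assoc : ∀ a b → e ⊝ (a ⊕ b) ≡ e ⊝ a ⊝ b
    ⊝-⊕-assoc a b = trans (cong (e ⊕_) (sym (⁻¹-∙-comm a b))) (sym (G.assoc e (⊖ a) (⊖ b)))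

  scale : ℤ → Poly → Poly
  scale k = map (map₂ (k *_))

  scale-· : ∀ k A H e → (scale k A · H) e ≡ k * (A · H) e
  scale-· k A H e = trans (∑-map _ _ A) (trans (∑-cong A λ { (a , c) → ℤP.*-assoc k c _ })
    (*-distribˡ-∑ k (λ { (a , c) → c * H (e ⊝ a) }) A))

  poly-ext : ∀ A B → (∀ e → (A · δ) e ≡ (B · δ) e) → ∀ H e → (A · H) e ≡ (B · H) e
  poly-ext A B A≗B H e = ℤP.i-j≡0⇒i≡j _ _
    (trans (sym (difference H e))
      (poly-zero (A ++ scale -1ℤ B) (λ x → trans (difference δ x) (ℤP.i≡j⇒i-j≡0 (A≗B x))) H e))
    where
    difference : ∀ H e → ((A ++ scale -1ℤ B) · H) e ≡ (A · H) e - (B · H) e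
    difference H e = trans (∑-++ _ A (scale -1ℤ B))
      (+-congˡ ((A · H) e) (trans (scale-· -1ℤ B H e) (ℤP.-1*i≡-i _)))

  -- Cancellation on series bounded below

  Bounded : Series → Set
  Bounded H = ∃ λ m → ∀ e → ¬ (m ≼ e) → H e ≡ 0ℤ

  bounded-+ : ∀ {H K} → Bounded H → Bounded K → Bounded (λ e → H e + K e)
  bounded-+ (m , H≡0) (m′ , K≡0) = m ⊓ m′ , λ e m⋠e →
    cong₂ _+_ (H≡0 e (m⋠e ∘ ⊓-lowerˡ m m′)) (K≡0 e (m⋠e ∘ ⊓-lowerʳ m m′))

  bounded-· : ∀ A {H} → Bounded H → Bounded (A · H)
  bounded-· []            (m , H≡0) = m , λ _ _ → refl
  bounded-· ((a , c) ∷ A) {H} (m , H≡0) = bounded-+ {K = A · H}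
    (m ⊕ a , λ e m⋠e → trans (cong (c *_) (H≡0 _ (m⋠e ∘ ≼-translate m a))) (ℤP.*-zeroʳ c))
    (bounded-· A (m , H≡0))

  -- The coefficient of the product at e + a, for a the least exponent of A, is c · H e plus terms
  -- that involve H only below e.
  sorted-cancel : ∀ {A} → Sorted A → ∀ {H} → Bounded H → ∀ a₀ → (A · δ) a₀ ≢ 0ℤ →
    (∀ e → (A · H) e ≡ 0ℤ) → ∀ e → H e ≡ 0ℤ
  sorted-cancel [] bH a₀ ≢0 _ = contradiction refl ≢0
  sorted-cancel {(a , c) ∷ A} (a<A ∷ sA) {H} bH a₀ ≢0 AH≡0 with c ℤ.≟ 0ℤ
  ... | yes refl = sorted-cancel sA bH a₀ (≢0 ∘ trans (drop-zero a A δ a₀))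
                     (λ e → trans (sym (drop-zero a A H e)) (AH≡0 e))
  ... | no c≢0 = bounded-induction (proj₁ bH) _ (proj₂ bH) step
    where
    step : ∀ e → (∀ e′ → e′ ≺ e → H e′ ≡ 0ℤ) → H e ≡ 0ℤ
    step e IH with ℤP.i*j≡0⇒i≡0∨j≡0 c (trans (sym (trans
      (cong₂ _+_ (cong (λ z → c * H z) (⊕-⊝ e a))
        (∑-zero (All.map (λ { {b , d} a<b → trans
          (cong (d *_) (IH _ (subst (e ⊕ a ⊝ b ≺_) (⊕-⊝ e b) (⊕-monoˡ-≺ (⊖ b)
            (subst₂ _≺_ (G.comm a e) (G.comm b e) (⊕-monoˡ-≺ e a<b))))))
          (ℤP.*-zeroʳ d) }) a<A)))
      (ℤP.+-identityʳ _))) (AH≡0 (e ⊕ a)))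
    ... | inj₁ c≡0 = contradiction c≡0 c≢0
    ... | inj₂ h≡0 = h≡0

  Nonzero : Poly → Set
  Nonzero A = ∃ λ a → (A · δ) a ≢ 0ℤ

  sorted-nonzero : ∀ {A} → Sorted A → ∀ H e → (A · H) e ≢ 0ℤ → Nonzero A
  sorted-nonzero [] H e ≢0 = contradiction refl ≢0
  sorted-nonzero {(a , c) ∷ A} (a<A ∷ sA) H e ≢0 with c ℤ.≟ 0ℤ
  ... | no c≢0   = a , c≢0 ∘ trans (sym (head-coeff a<A))
  ... | yes refl with sorted-nonzero sA H e (≢0 ∘ trans (drop-zero a A H e))
  ...   | b , ≢0′ = b , ≢0′ ∘ trans (sym (drop-zero a A δ b))

  -- The contrapositive of `poly-zero`, with a witness. It allows a denominator to be shown nonzero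
  -- from one value of its product with a series, without expanding the denominator.
  ·-nonzero : ∀ A H e → (A · H) e ≢ 0ℤ → Nonzero A
  ·-nonzero A H e ≢0 with sorted-nonzero (sort-Sorted A) H e (≢0 ∘ trans (sym (sort-· A H e)))
  ... | a , ≢0′ = a , ≢0′ ∘ trans (sort-· A δ a)

  cancel : ∀ A → Nonzero A → ∀ {H K} → Bounded H → Bounded K →
    (∀ e → (A · H) e ≡ (A · K) e) → ∀ e → H e ≡ K e
  cancel A (a , ≢0) {H} {K} bH (m , K≡0) AH≡AK e =
    ℤP.i-j≡0⇒i≡j (H e) (K e) (trans (+-congˡ (H e) (sym (ℤP.-1*i≡-i (K e))))
      (sorted-cancel (sort-Sorted A) {λ x → H x + -1ℤ * K x}
        (bounded-+ bH (m , λ e m⋠e → cong (-1ℤ *_) (K≡0 e m⋠e)))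
        a (≢0 ∘ trans (sym (sort-· A δ a)))
        (λ e → trans (sort-· A (λ x → H x + -1ℤ * K x) e) (trans (·-+ A H (λ x → -1ℤ * K x) e)
          (trans (+-congˡ ((A · H) e) (trans (·-*ˡ A -1ℤ K e) (ℤP.-1*i≡-i _)))
            (ℤP.i≡j⇒i-j≡0 (AH≡AK e)))))
        e))

  -- Reflection and the functional equation

  δ-even : ∀ e → δ (⊖ e) ≡ δ e
  δ-even e = ind-cong _ _ (λ eq → trans (sym ε⁻¹≈ε) (trans (cong ⊖_ eq) (⁻¹-involutive e)))
                          (λ eq → trans (sym ε⁻¹≈ε) (cong ⊖_ eq))

  inv-δ : ∀ A e → (inv A · δ) e ≡ (A · δ) (⊖ e)
  inv-δ A e = trans (inv-· A δ e) (·-cong A δ-even (⊖ e))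

  inv-·-⊖ : ∀ A H e → (inv A · (H ∘ ⊖_)) e ≡ (A · H) (⊖ e)
  inv-·-⊖ A H e = trans (inv-· A (H ∘ ⊖_) e) (·-cong A (λ x → cong H (⁻¹-involutive x)) (⊖ e))

  laur-𝟘 : ∀ A B e → laur 𝟘 A B e ≡ (inv A · B · δ) e
  laur-𝟘 A B e = trans (laur-· 𝟘 A B e) (·-cong (inv A) (λ x → trans (mono-1-· 𝟘 (B · δ) x)
    (cong (B · δ) (trans (cong (x ⊕_) ε⁻¹≈ε) (G.identityʳ x)))) e)

  inv-Nonzero : ∀ A → Nonzero A → Nonzero (inv A)
  inv-Nonzero A (a , ≢0) = ⊖ a , ≢0 ∘ trans (sym (trans (inv-δ A (⊖ a)) (cong (A · δ) (⁻¹-involutive a))))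

  -- G° plays the role of the interior series: the hypothesis says that the rational functions
  -- G°(x) and σ G(1/x) agree.
  module Reciprocity (G G° : Series) (Q₀ P₀ : Poly) (σ : ℤ) (σ²≡1 : σ * σ ≡ 1ℤ)
    (rational : ∀ e → (Q₀ · G) e ≡ (P₀ · δ) e)
    (reciprocity : ∀ e → (inv Q₀ · G°) e ≡ σ * (Q₀ · G) (⊖ e)) where

    open ≡-Reasoning

    inv-P₀ : ∀ e → (inv P₀ · δ) e ≡ σ * (inv Q₀ · G°) e
    inv-P₀ e = begin
      (inv P₀ · δ) e              ≡⟨ inv-δ P₀ e ⟩
      (P₀ · δ) (⊖ e)              ≡⟨ rational (⊖ e) ⟨
      (Q₀ · G) (⊖ e)              ≡⟨ ℤP.*-identityˡ _ ⟨
      1ℤ * (Q₀ · G) (⊖ e)         ≡⟨ cong (_* (Q₀ · G) (⊖ e)) σ²≡1 ⟨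
      σ * σ * (Q₀ · G) (⊖ e)      ≡⟨ ℤP.*-assoc σ σ _ ⟩
      σ * (σ * (Q₀ · G) (⊖ e))    ≡⟨ cong (σ *_) (reciprocity e) ⟨
      σ * (inv Q₀ · G°) e         ∎

    -- With `H` the numerator of `G°`, reciprocity becomes an identity between Laurent polynomials
    -- alone; in this form it can be specialized to the total degree.
    numerator-reciprocity : ∀ H → (∀ e → (Q₀ · G°) e ≡ (H · δ) e) →
      ∀ e → (Q₀ · inv P₀ · δ) e ≡ σ * (inv Q₀ · H · δ) e
    numerator-reciprocity H interior e = begin
      (Q₀ · inv P₀ · δ) e                    ≡⟨ ·-cong Q₀ inv-P₀ e ⟩
      (Q₀ · (λ x → σ * (inv Q₀ · G°) x)) e   ≡⟨ ·-*ˡ Q₀ σ (inv Q₀ · G°) e ⟩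
      σ * (Q₀ · inv Q₀ · G°) e               ≡⟨ cong (σ *_) (·-comm Q₀ (inv Q₀) G° e) ⟩
      σ * (inv Q₀ · Q₀ · G°) e               ≡⟨ cong (σ *_) (·-cong (inv Q₀) interior e) ⟩
      σ * (inv Q₀ · H · δ) e                 ∎

    translate⇒functional-equation : ∀ c → (∀ e → G° e ≡ G (e ⊝ c)) →
      ∀ e → laur 𝟘 P₀ Q₀ e ≡ σ * laur c Q₀ P₀ e
    translate⇒functional-equation c G°≡ e = begin
      laur 𝟘 P₀ Q₀ e                            ≡⟨ laur-𝟘 P₀ Q₀ e ⟩
      (inv P₀ · Q₀ · δ) e                       ≡⟨ ·-comm (inv P₀) Q₀ δ e ⟩
      (Q₀ · inv P₀ · δ) e                       ≡⟨ ·-cong Q₀ inv-P₀ e ⟩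
      (Q₀ · (λ x → σ * (inv Q₀ · G°) x)) e      ≡⟨ ·-*ˡ Q₀ σ (inv Q₀ · G°) e ⟩
      σ * (Q₀ · inv Q₀ · G°) e                  ≡⟨ cong (σ *_) (·-comm Q₀ (inv Q₀) G° e) ⟩
      σ * (inv Q₀ · Q₀ · G°) e                  ≡⟨ cong (σ *_) (·-cong (inv Q₀) (·-cong Q₀ shift) e) ⟩
      σ * (inv Q₀ · Q₀ · mono 1ℤ c · G) e       ≡⟨ cong (σ *_) (·-cong (inv Q₀) (·-comm Q₀ (mono 1ℤ c) G) e) ⟩
      σ * (inv Q₀ · mono 1ℤ c · Q₀ · G) e       ≡⟨ cong (σ *_) (·-cong (inv Q₀) (·-cong (mono 1ℤ c) rational) e) ⟩
      σ * (inv Q₀ · mono 1ℤ c · P₀ · δ) e       ≡⟨ cong (σ *_) (laur-· c Q₀ P₀ e) ⟨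
      σ * laur c Q₀ P₀ e                        ∎
      where
      shift : ∀ e → G° e ≡ (mono 1ℤ c · G) e
      shift e = trans (G°≡ e) (sym (mono-1-· c G e))

    functional-equation⇒translate : Bounded G → Bounded G° → Nonzero Q₀ →
      ∀ P Q → Nonzero Q → (∀ e → (Q · G) e ≡ (P · δ) e) →
      ∀ ε m → (∀ e → laur 𝟘 P Q e ≡ ε * laur m Q P e) →
      ∀ e → G° e ≡ σ * ε * G (e ⊝ m)
    functional-equation⇒translate bG bG° nzQ₀ P Q nzQ QG≡P ε m fe e =
      trans (cancel (inv Q₀) (inv-Nonzero Q₀ nzQ₀) bG° bK
              (cancel (inv Q) (inv-Nonzero Q nzQ) (bounded-· (inv Q₀) bG°) (bounded-· (inv Q₀) bK)
                (cancel Q nzQ (bounded-· (inv Q) (bounded-· (inv Q₀) bG°))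
                  (bounded-· (inv Q) (bounded-· (inv Q₀) bK)) key)) e)
            (mono-· (σ * ε) m G e)
      where
      R : Poly
      R = inv Q₀

      M T S K : Series
      M = mono 1ℤ m · G
      T = R · M
      S = inv Q · T
      K = mono (σ * ε) m · G

      bK : Bounded K
      bK = bounded-· (mono (σ * ε) m) bG

      RG° : ∀ e → (R · G°) e ≡ σ * (R · (G ∘ ⊖_)) e
      RG° e = trans (reciprocity e) (cong (σ *_) (sym (inv-·-⊖ Q₀ G e)))

      inv-P : ∀ e → (inv Q · (G ∘ ⊖_)) e ≡ (inv P · δ) e
      inv-P e = trans (inv-·-⊖ Q G e) (trans (QG≡P (⊖ e)) (sym (inv-δ P e)))

      fe′ : ∀ e → (inv P · Q · δ) e ≡ ε * (inv Q · mono 1ℤ m · P · δ) e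
      fe′ e = trans (sym (laur-𝟘 P Q e)) (trans (fe e) (cong (ε *_) (laur-· m Q P e)))

      K-scale : ∀ e → σ * (ε * (mono 1ℤ m · G) e) ≡ K e
      K-scale e = trans (cong (λ z → σ * (ε * z)) (mono-1-· m G e))
        (trans (sym (ℤP.*-assoc σ ε _)) (sym (mono-· (σ * ε) m G e)))

      -- Under Q(1/x) the reflected series becomes the polynomial P(1/x), to which `fe′` applies;
      -- the P on its other side is then turned back into Q G, which is no longer reflected.
      key : ∀ e → (Q · inv Q · R · G°) e ≡ (Q · inv Q · R · K) e
      key e = begin
        (Q · inv Q · R · G°) e
          ≡⟨ ·-cong Q (λ x → trans (·-cong (inv Q) RG° x) (·-*ˡ (inv Q) σ (R · (G ∘ ⊖_)) x)) e ⟩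
        (Q · (λ x → σ * (inv Q · R · (G ∘ ⊖_)) x)) e
          ≡⟨ ·-*ˡ Q σ (inv Q · R · (G ∘ ⊖_)) e ⟩
        σ * (Q · inv Q · R · (G ∘ ⊖_)) e
          ≡⟨ cong (σ *_) (·-cong Q (·-comm (inv Q) R (G ∘ ⊖_)) e) ⟩
        σ * (Q · R · inv Q · (G ∘ ⊖_)) e
          ≡⟨ cong (σ *_) (·-cong Q (·-cong R inv-P) e) ⟩
        σ * (Q · R · inv P · δ) e
          ≡⟨ cong (σ *_) (trans (·-comm Q R (inv P · δ) e) (·-cong R (·-comm Q (inv P) δ) e)) ⟩
        σ * (R · inv P · Q · δ) e
          ≡⟨ cong (σ *_) (trans (·-cong R fe′ e) (·-*ˡ R ε (inv Q · mono 1ℤ m · P · δ) e)) ⟩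
        σ * (ε * (R · inv Q · mono 1ℤ m · P · δ) e)
          ≡⟨ cong (λ z → σ * (ε * z)) (·-cong R (·-cong (inv Q) (·-cong (mono 1ℤ m) (λ x → sym (QG≡P x)))) e) ⟩
        σ * (ε * (R · inv Q · mono 1ℤ m · Q · G) e)
          ≡⟨ cong (λ z → σ * (ε * z)) (·-cong R (λ x → trans (·-cong (inv Q) (·-comm (mono 1ℤ m) Q G) x)
               (·-comm (inv Q) Q (mono 1ℤ m · G) x)) e) ⟩
        σ * (ε * (R · Q · inv Q · mono 1ℤ m · G) e)
          ≡⟨ cong (λ z → σ * (ε * z)) (trans (·-comm R Q (inv Q · mono 1ℤ m · G) e)
               (·-cong Q (·-comm R (inv Q) (mono 1ℤ m · G)) e)) ⟩
        σ * (ε * (Q · inv Q · R · mono 1ℤ m · G) e)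
          ≡⟨ trans (cong (σ *_) (sym (·-*ˡ Q ε S e))) (sym (·-*ˡ Q σ (λ x → ε * S x) e)) ⟩
        (Q · (λ x → σ * (ε * (inv Q · R · mono 1ℤ m · G) x))) e
          ≡⟨ ·-cong Q (λ x → trans (cong (σ *_) (sym (·-*ˡ (inv Q) ε T x))) (sym (·-*ˡ (inv Q) σ (λ y → ε * T y) x))) e ⟩
        (Q · inv Q · (λ x → σ * (ε * (R · mono 1ℤ m · G) x))) e
          ≡⟨ ·-cong Q (·-cong (inv Q) (λ x → trans (cong (σ *_) (sym (·-*ˡ R ε M x))) (sym (·-*ˡ R σ (λ y → ε * M y) x)))) e ⟩
        (Q · inv Q · R · (λ x → σ * (ε * (mono 1ℤ m · G) x))) e
          ≡⟨ ·-cong Q (·-cong (inv Q) (·-cong R K-scale)) e ⟩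
        (Q · inv Q · R · K) e ∎

-- The exponent groups ℤ and ℤⁿ

ℤ-bounded-induction : ∀ m (P : ℤ → Set) → (∀ e → ¬ (m ℤ.≤ e) → P e) →
  (∀ e → (∀ e′ → e′ ℤ.< e → P e′) → P e) → ∀ e → P e
-- The counter only has to satisfy e < m + k; for e below m the absolute value merely overestimates
-- it.
ℤ-bounded-induction m P out step e = below (suc ℤ.∣ e - m ∣) e (begin-strict
    e                        ≡⟨ cancelled m e ⟨
    m + (e - m)              ≤⟨ ℤP.+-monoʳ-≤ m (i≤+∣i∣ (e - m)) ⟩
    m + + ℤ.∣ e - m ∣        <⟨ ℤP.+-monoʳ-< m (ℤ.+<+ (ℕP.n<1+n _)) ⟩
    m + + suc ℤ.∣ e - m ∣    ∎)
  where
  open ℤP.≤-Reasoning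
  cancelled : ∀ m e → m + (e - m) ≡ e
  cancelled = solve-∀
  i≤+∣i∣ : ∀ i → i ℤ.≤ + ℤ.∣ i ∣
  i≤+∣i∣ (+ n)    = ℤP.≤-refl
  i≤+∣i∣ -[1+ n ] = ℤ.-≤+
  shuffle : ∀ m k → m + (1ℤ + k) ≡ 1ℤ + (m + k)
  shuffle = solve-∀
  below : ∀ k e → e ℤ.< m + + k → P e
  below zero    e e<m = out e (ℤP.<⇒≱ (subst (e ℤ.<_) (ℤP.+-identityʳ m) e<m))
  below (suc k) e e<  = step e λ e′ e′<e → below k e′ (ℤP.≰⇒> λ m+k≤e′ → ℤP.<⇒≱ (begin-strict
    1ℤ + e′          ≤⟨ ℤP.i<j⇒suc[i]≤j e′<e ⟩
    e                <⟨ e< ⟩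
    m + (1ℤ + + k)   ≡⟨ shuffle m (+ k) ⟩
    1ℤ + (m + + k)   ∎) (ℤP.+-monoʳ-≤ 1ℤ m+k≤e′))

ℤ-exponents : OrderedExponents
ℤ-exponents = record
  { E                 = ℤ
  ; _⊕_               = _+_
  ; 𝟘                 = 0ℤ
  ; ⊖_                = neg
  ; isAbelianGroup    = ℤP.+-0-isAbelianGroup
  ; _≟_               = ℤ._≟_
  ; _≺_               = ℤ._<_
  ; ≺-cmp             = ℤP.<-cmp
  ; ≺-trans           = ℤP.<-trans
  ; ⊕-monoˡ-≺         = λ e → ℤP.+-monoˡ-< e
  ; _≼_               = ℤ._≤_
  ; ≼-translate       = ℤ-translate
  ; _⊓_               = ℤ._⊓_
  ; ⊓-lowerˡ          = λ a b → ℤP.≤-trans (ℤP.i⊓j≤i a b)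
  ; ⊓-lowerʳ          = λ a b → ℤP.≤-trans (ℤP.i⊓j≤j a b)
  ; bounded-induction = ℤ-bounded-induction
  }
  where
  ℤ-translate : ∀ m a {e} → m ℤ.≤ e - a → m + a ℤ.≤ e
  ℤ-translate m a {e} m≤ = subst (m + a ℤ.≤_) (cancelled e a) (ℤP.+-monoˡ-≤ a m≤)
    where
    cancelled : ∀ e a → e - a + a ≡ e
    cancelled = solve-∀

Lex : ∀ {n} → Vec ℤ n → Vec ℤ n → Set
Lex []       []       = ⊥
Lex (x ∷ xs) (y ∷ ys) = (x ℤ.< y) ⊎ (x ≡ y × Lex xs ys)

Lex-cmp : ∀ {n} → Trichotomous _≡_ (Lex {n})
Lex-cmp []       []       = tri≈ (λ ()) refl (λ ())
Lex-cmp (x ∷ xs) (y ∷ ys) with ℤP.<-cmp x y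
... | tri< x<y x≢y x≯y = tri< (inj₁ x<y) (x≢y ∘ VecP.∷-injectiveˡ)
                           (λ { (inj₁ y<x) → x≯y y<x ; (inj₂ (y≡x , _)) → x≢y (sym y≡x) })
... | tri> x≮y x≢y y<x = tri> (λ { (inj₁ x<y) → x≮y x<y ; (inj₂ (x≡y , _)) → x≢y x≡y })
                           (x≢y ∘ VecP.∷-injectiveˡ) (inj₁ y<x)
... | tri≈ x≮x refl _ with Lex-cmp xs ys
...   | tri< lt ne gt = tri< (inj₂ (refl , lt)) (ne ∘ VecP.∷-injectiveʳ)
                          (λ { (inj₁ x<x) → x≮x x<x ; (inj₂ (_ , l)) → gt l })
...   | tri≈ lt eq gt = tri≈ (λ { (inj₁ x<x) → x≮x x<x ; (inj₂ (_ , l)) → lt l }) (cong (x ∷_) eq)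
                          (λ { (inj₁ x<x) → x≮x x<x ; (inj₂ (_ , l)) → gt l })
...   | tri> lt ne gt = tri> (λ { (inj₁ x<x) → x≮x x<x ; (inj₂ (_ , l)) → lt l })
                          (ne ∘ VecP.∷-injectiveʳ) (inj₂ (refl , gt))

Lex-trans : ∀ {n} → Transitive (Lex {n})
Lex-trans {i = []} {[]} {[]} ()
Lex-trans {i = _ ∷ _} {_ ∷ _} {_ ∷ _} (inj₁ p)          (inj₁ q)          = inj₁ (ℤP.<-trans p q)
Lex-trans {i = _ ∷ _} {_ ∷ _} {_ ∷ _} (inj₁ p)          (inj₂ (refl , _)) = inj₁ p
Lex-trans {i = _ ∷ _} {_ ∷ _} {_ ∷ _} (inj₂ (refl , _)) (inj₁ q)          = inj₁ q
Lex-trans {i = _ ∷ _} {_ ∷ _} {_ ∷ _} (inj₂ (refl , p)) (inj₂ (refl , q)) = inj₂ (refl , Lex-trans p q)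

Lex-translate : ∀ {n} (e : Vec ℤ n) {a b} → Lex a b → Lex (zipWith _+_ a e) (zipWith _+_ b e)
Lex-translate []      {[]}    {[]}    ()
Lex-translate (z ∷ e) {_ ∷ _} {_ ∷ _} (inj₁ p)          = inj₁ (ℤP.+-monoˡ-< z p)
Lex-translate (z ∷ e) {_ ∷ _} {_ ∷ _} (inj₂ (refl , p)) = inj₂ (refl , Lex-translate e p)

-- A lexicographic descent that lowers the head may change the tail arbitrarily, so the outer
-- induction on the head proves the claim for all tails, and the inner one keeps the head fixed.
Vec-bounded-induction : ∀ {n} (m : Vec ℤ n) (P : Vec ℤ n → Set) → (∀ e → ¬ Pointwise ℤ._≤_ m e → P e) →
  (∀ e → (∀ e′ → Lex e′ e → P e′) → P e) → ∀ e → P e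
Vec-bounded-induction [] P out step [] = step [] λ { [] () }
Vec-bounded-induction (m ∷ ms) P out step (x ∷ v) =
  ℤ-bounded-induction m (λ x → ∀ v → P (x ∷ v))
    (λ x m≰x v → out (x ∷ v) λ { (m≤x ∷ _) → m≰x m≤x })
    (λ x IHx → Vec-bounded-induction ms (λ v → P (x ∷ v))
      (λ v ms≰v → out (x ∷ v) λ { (_ ∷ ms≤v) → ms≰v ms≤v })
      (λ v IHv → step (x ∷ v) λ { (y ∷ w) (inj₁ y<x) → IHx y y<x w
                                 ; (y ∷ w) (inj₂ (refl , w<v)) → IHv w w<v }))
    x v

-- Vectors replace functions on `Fin n` because the exponent group needs decidable propositional
-- equality.
Vec-exponents : ℕ → OrderedExponents
Vec-exponents n = record
  { E                 = Vec ℤ n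
  ; _⊕_               = zipWith _+_
  ; 𝟘                 = replicate n 0ℤ
  ; ⊖_                = Vec.map neg
  ; isAbelianGroup    = isAbelianGroup
  ; _≟_               = VecP.≡-dec ℤ._≟_
  ; _≺_               = Lex
  ; ≺-cmp             = Lex-cmp
  ; ≺-trans           = Lex-trans
  ; ⊕-monoˡ-≺         = λ e → Lex-translate e
  ; _≼_               = Pointwise ℤ._≤_
  ; ≼-translate       = translate
  ; _⊓_               = zipWith ℤ._⊓_
  ; ⊓-lowerˡ          = lowerˡ
  ; ⊓-lowerʳ          = lowerʳ
  ; bounded-induction = Vec-bounded-induction
  }
  where
  module Zₑ = OrderedExponents ℤ-exponents
  isAbelianGroup : IsAbelianGroup _≡_ (zipWith _+_) (replicate n 0ℤ) (Vec.map neg)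
  isAbelianGroup = record
    { isGroup = record
      { isMonoid = record
        { isSemigroup = record
          { isMagma = record { isEquivalence = isEquivalence ; ∙-cong = cong₂ (zipWith _+_) }
          ; assoc   = VecP.zipWith-assoc ℤP.+-assoc }
        ; identity = VecP.zipWith-identityˡ ℤP.+-identityˡ , VecP.zipWith-identityʳ ℤP.+-identityʳ }
      ; inverse = VecP.zipWith-inverseˡ ℤP.+-inverseˡ , VecP.zipWith-inverseʳ ℤP.+-inverseʳ
      ; ⁻¹-cong = cong (Vec.map neg) }
    ; comm = VecP.zipWith-comm ℤP.+-comm }
  translate : ∀ {n} (m a : Vec ℤ n) {e : Vec ℤ n} → Pointwise ℤ._≤_ m (zipWith _+_ e (Vec.map neg a)) →
    Pointwise ℤ._≤_ (zipWith _+_ m a) e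
  translate []      []      {[]}    []       = []
  translate (m ∷ ms) (a ∷ as) {x ∷ e} (p ∷ ps) = Zₑ.≼-translate m a p ∷ translate ms as ps
  lowerˡ : ∀ {n} (a b : Vec ℤ n) {e : Vec ℤ n} → Pointwise ℤ._≤_ a e → Pointwise ℤ._≤_ (zipWith ℤ._⊓_ a b) e
  lowerˡ []       []       []       = []
  lowerˡ (a ∷ as) (b ∷ bs) (p ∷ ps) = Zₑ.⊓-lowerˡ a b p ∷ lowerˡ as bs ps
  lowerʳ : ∀ {n} (a b : Vec ℤ n) {e : Vec ℤ n} → Pointwise ℤ._≤_ b e → Pointwise ℤ._≤_ (zipWith ℤ._⊓_ a b) e
  lowerʳ []       []       []       = []
  lowerʳ (a ∷ as) (b ∷ bs) (p ∷ ps) = Zₑ.⊓-lowerʳ a b p ∷ lowerʳ as bs ps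

-- The lecture hall cone

module V n = Laurent (Vec-exponents n)
module U = Laurent ℤ-exponents

emb : ∀ {n} → (Fin n → ℕ) → Vec ℤ n
emb b = tabulate (λ i → + b i)

NonNeg : ∀ {n} → Vec ℤ n → Set
NonNeg {n} = Pointwise ℤ._≤_ (replicate n 0ℤ)

Positive : (ℕ → ℕ) → Set
Positive s = ∀ i → 1 ℕ.≤ i → 0 ℕ.< s i

positive-∘suc : ∀ {s} → Positive s → Positive (s ∘ suc)
positive-∘suc s>0 i 1≤i = s>0 (suc i) (ℕP.m≤n⇒m≤1+n 1≤i)

infixl 6 _⊞[_]_
_⊞[_]_ : ∀ {n} → Vec ℤ n → ℤ → (Fin n → ℕ) → Vec ℤ n
v ⊞[ k ] b = zipWith _+_ v (Vec.map (k *_) (emb b))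

-- The product over j of u (s_j s_{j-1}) (λ_j s_{j-1} − λ_{j-1} s_j), where t and p
-- stand for s_0 and λ_0.
W : (ℕ → ℤ → ℤ) → (ℕ → ℕ) → ∀ {n} → ℕ → ℤ → Vec ℤ n → ℤ
W u s t p []      = 1ℤ
W u s t p (x ∷ v) = u (s 1 ℕ.* t) (x * + t - p * + s 1) * W u (s ∘ suc) (s 1) x v

-- The ray v_1 = (s_1,...,s_n); the other rays arise in the recursion from shifted sequences padded
-- with zeros.
prefix : (ℕ → ℕ) → ∀ n → Fin n → ℕ
prefix s n i = s (suc (toℕ i))

-- ∏_j (1 − x_j^{s_j} ⋯ x_n^{s_n})
denominator : (ℕ → ℕ) → (n : ℕ) → MPoly n
denominator s zero    = ((λ ()) , 1ℤ) ∷ []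
denominator s (suc n) = map (map₁ (0 ∷v_)) D ++ map (λ { (b , c) → (λ i → (0 ∷v b) i ℕ.+ prefix s (suc n) i) , - c }) D
  where
  D : MPoly n
  D = denominator (s ∘ suc) n

-- Multiplying a product W u by 1 − x^{-k v}, where v is the ray on which only the j-th linear
-- form is nonzero (with value N), changes only the j-th factor, namely u N y into Δ k u N y.
Δ : ℤ → (ℕ → ℤ → ℤ) → ℕ → ℤ → ℤ
Δ k u N y = u N y - u N (y + k * + N)

-- Every form λ_j s_{j-1} - λ_{j-1} s_j vanishes on the vector (s_0,...,s_n), here (t, s_1,...,s_n).
W-translate : ∀ u s {n} t p k (v : Vec ℤ n) → W u s t (p + k * + t) (v ⊞[ k ] prefix s n) ≡ W u s t p v
W-translate u s t p k []      = refl
W-translate u s t p k (x ∷ v) = cong₂ _*_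
  (cong (u (s 1 ℕ.* t)) (identity x p k (+ t) (+ s 1)))
  (W-translate u (s ∘ suc) (s 1) x k v)
  where
  identity : ∀ x p k t a → (x + k * a) * t - (p + k * t) * a ≡ x * t - p * a
  identity = solve-∀

⊞-+ : ∀ {n} (v : Vec ℤ n) k b c → v ⊞[ k ] (λ i → b i ℕ.+ c i) ≡ v ⊞[ k ] b ⊞[ k ] c
⊞-+ []      k b c = refl
⊞-+ (x ∷ v) k b c = cong₂ _∷_ (identity x k (+ b zero) (+ c zero)) (⊞-+ v k (b ∘ suc) (c ∘ suc))
  where
  identity : ∀ x k b c → x + k * (b + c) ≡ x + k * b + k * c
  identity = solve-∀

-- The later rays have first coordinate 0 and leave the first form alone. The first ray raises that
-- form by its value N = s_1 t there and, by `W-translate`, fixes all others. So the product over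
-- the rays splits along the factors of `W`. The value k = -1 belongs to Q₀, k = 1 to Q₀(1/x).
denominator-W : ∀ u k s n t p (v : Vec ℤ n) →
  ∑ (denominator s n) (λ { (b , c) → c * W u s t p (v ⊞[ k ] b) }) ≡ W (Δ k u) s t p v
denominator-W u k s zero    t p []      = refl
denominator-W u k s (suc n) t p (x ∷ v) = begin
  ∑ (map (map₁ (0 ∷v_)) D ++ map _ D) f
    ≡⟨ ∑-++ f (map (map₁ (0 ∷v_)) D) _ ⟩
  ∑ (map (map₁ (0 ∷v_)) D) f + ∑ (map _ D) f
    ≡⟨ cong₂ _+_ (∑-map f _ D) (∑-map f _ D) ⟩
  ∑ D (λ x → f (map₁ (0 ∷v_) x)) + ∑ D _
    ≡⟨ cong₂ _+_ (trans (∑-cong D unshifted) (*-distribˡ-∑ (u N y) g D))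
                 (trans (∑-cong D shifted) (*-distribˡ-∑ (- u N (y + k * + N)) g D)) ⟩
  u N y * ∑ D g + - u N (y + k * + N) * ∑ D g
    ≡⟨ ℤP.*-distribʳ-+ (∑ D g) (u N y) _ ⟨
  Δ k u N y * ∑ D g
    ≡⟨ cong (Δ k u N y *_) (denominator-W u k (s ∘ suc) n (s 1) x v) ⟩
  Δ k u N y * W (Δ k u) (s ∘ suc) (s 1) x v ∎
  where
  open ≡-Reasoning
  D : MPoly n
  D = denominator (s ∘ suc) n
  N : ℕ
  N = s 1 ℕ.* t
  y : ℤ
  y = x * + t - p * + s 1
  f : (Fin (suc n) → ℕ) × ℤ → ℤ
  f (b , c) = c * W u s t p ((x ∷ v) ⊞[ k ] b)
  g : (Fin n → ℕ) × ℤ → ℤ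
  g (b , c) = c * W u (s ∘ suc) (s 1) x (v ⊞[ k ] b)
  exchange : ∀ a b c → a * (b * c) ≡ b * (a * c)
  exchange = solve-∀
  unshifted : ∀ z → f (map₁ (0 ∷v_) z) ≡ u N y * g z
  unshifted (b , c) = trans
    (cong (λ x′ → c * (u N (x′ * + t - p * + s 1) * W u (s ∘ suc) (s 1) x′ (v ⊞[ k ] b)))
      (trans (+-congˡ x (ℤP.*-zeroʳ k)) (ℤP.+-identityʳ x)))
    (exchange c (u N y) _)
  identity : ∀ x p k t a → (x + k * a) * t - p * a ≡ x * t - p * a + k * (a * t)
  identity = solve-∀
  exchange- : ∀ a b c → - a * (b * c) ≡ - b * (a * c)
  exchange- = solve-∀
  shifted : ∀ z → f ((λ i → (0 ∷v proj₁ z) i ℕ.+ prefix s (suc n) i) , - proj₂ z) ≡ - u N (y + k * + N) * g z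
  shifted (b , c) = trans
    (cong₂ (λ y′ w → - c * (u N y′ * w))
      (trans (identity x p k (+ t) (+ s 1)) (cong (λ z → y + k * z) (sym (ℤP.pos-* (s 1) t))))
      (trans (cong (W u (s ∘ suc) (s 1) _) (⊞-+ v k b (prefix (s ∘ suc) n)))
        (W-translate u (s ∘ suc) (s 1) x k (v ⊞[ k ] b))))
    (exchange- c (u N (y + k * + N)) _)

-- Reciprocity, factor by factor

[0≤] [0<] : ℕ → ℤ → ℤ
[0≤] _ y = ind (0ℤ ℤ.≤? y)
[0<] _ y = ind (0ℤ ℤ.<? y)

sgn : ℕ → ℤ
sgn zero    = 1ℤ
sgn (suc n) = -1ℤ * sgn n

sgn² : ∀ n → sgn n * sgn n ≡ 1ℤ
sgn² zero    = refl
sgn² (suc n) = trans (identity (sgn n)) (sgn² n)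
  where
  identity : ∀ a → -1ℤ * a * (-1ℤ * a) ≡ a * a
  identity = solve-∀

sgn-Sign : ∀ n → Sign (sgn n)
sgn-Sign zero    = inj₁ refl
sgn-Sign (suc n) with sgn-Sign n
... | inj₁ eq = inj₂ (cong (-1ℤ *_) eq)
... | inj₂ eq = inj₁ (cong (-1ℤ *_) eq)

[0<]-reflect : ∀ N M y → [0<] N y ≡ 1ℤ - [0≤] M (- y)
[0<]-reflect N M y with 0ℤ ℤ.<? y | 0ℤ ℤ.≤? - y
... | yes 0<y | yes 0≤-y = contradiction (ℤP.<-≤-trans 0<y (subst (ℤ._≤ 0ℤ) (ℤP.neg-involutive y) (ℤP.neg-mono-≤ 0≤-y))) (ℤP.<-irrefl refl)
... | yes _   | no _     = refl
... | no _    | yes _    = refl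
... | no 0≮y  | no 0≰-y  = contradiction (ℤP.neg-mono-≤ (ℤP.≮⇒≥ 0≮y)) 0≰-y

-- The condition 0 < y is the complement of 0 ≤ -y. The constant 1 disappears in the difference, and
-- each coordinate contributes one sign.
Δ-reflect : ∀ N y → Δ 1ℤ [0<] N y ≡ -1ℤ * Δ -1ℤ [0≤] N (- y)
Δ-reflect N y = begin
  [0<] N y - [0<] N (y + 1ℤ * + N)
    ≡⟨ cong₂ _-_ ([0<]-reflect N N y) ([0<]-reflect N N (y + 1ℤ * + N)) ⟩
  (1ℤ - [0≤] N (- y)) - (1ℤ - [0≤] N (- (y + 1ℤ * + N)))
    ≡⟨ cong (λ z → (1ℤ - [0≤] N (- y)) - (1ℤ - [0≤] N z)) (argument y (+ N)) ⟩
  (1ℤ - [0≤] N (- y)) - (1ℤ - [0≤] N (- y + -1ℤ * + N))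
    ≡⟨ collect ([0≤] N (- y)) ([0≤] N (- y + -1ℤ * + N)) ⟩
  -1ℤ * ([0≤] N (- y) - [0≤] N (- y + -1ℤ * + N)) ∎
  where
  open ≡-Reasoning
  argument : ∀ y N → - (y + 1ℤ * N) ≡ - y + -1ℤ * N
  argument = solve-∀
  collect : ∀ a b → (1ℤ - a) - (1ℤ - b) ≡ -1ℤ * (a - b)
  collect = solve-∀

W-reflect : ∀ s {n} t p (v : Vec ℤ n) →
  W (Δ 1ℤ [0<]) s t p v ≡ sgn n * W (Δ -1ℤ [0≤]) s t (- p) (Vec.map neg v)
W-reflect s t p []      = refl
W-reflect s {suc n} t p (x ∷ v) = begin
  Δ 1ℤ [0<] N y * W (Δ 1ℤ [0<]) (s ∘ suc) (s 1) x v
    ≡⟨ cong₂ _*_ (trans (Δ-reflect N y) (cong (λ z → -1ℤ * Δ -1ℤ [0≤] N z) (argument x p (+ t) (+ s 1))))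
         (W-reflect (s ∘ suc) (s 1) x v) ⟩
  -1ℤ * a * (sgn n * b)
    ≡⟨ rearrange a (sgn n) b ⟩
  sgn (suc n) * (a * b) ∎
  where
  open ≡-Reasoning
  N : ℕ
  N = s 1 ℕ.* t
  y a b : ℤ
  y = x * + t - p * + s 1
  a = Δ -1ℤ [0≤] N (- x * + t - - p * + s 1)
  b = W (Δ -1ℤ [0≤]) (s ∘ suc) (s 1) (- x) (Vec.map neg v)
  argument : ∀ x p t a → - (x * t - p * a) ≡ - x * t - - p * a
  argument = solve-∀
  rearrange : ∀ a g b → -1ℤ * a * (g * b) ≡ -1ℤ * g * (a * b)
  rearrange = solve-∀

-- Supports and degree bounds

*-≢0ˡ : ∀ {a b} → a * b ≢ 0ℤ → a ≢ 0ℤ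
*-≢0ˡ ab≢0 refl = ab≢0 refl

*-≢0ʳ : ∀ a {b} → a * b ≢ 0ℤ → b ≢ 0ℤ
*-≢0ʳ a ab≢0 refl = ab≢0 (ℤP.*-zeroʳ a)

vanishes : ∀ {P : Set} i → (i ≢ 0ℤ → P) → ¬ P → i ≡ 0ℤ
vanishes i f ¬p = decidable-stable (i ℤ.≟ 0ℤ) (¬p ∘ f)

head-nonNeg : ∀ {t} a {x p} → 0 ℕ.< t → 0ℤ ℤ.≤ p → 0ℤ ℤ.≤ x * + t - p * + a → 0ℤ ℤ.≤ x
head-nonNeg {suc t} a {x} {p} _ 0≤p 0≤y = ℤP.*-cancelʳ-≤-pos 0ℤ x (+ suc t)
  (ℤP.≤-trans (ℤP.*-monoʳ-≤-nonNeg (+ a) 0≤p) (ℤP.0≤i-j⇒j≤i 0≤y))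

-- Since t ≥ 1, x ≤ x t = y + p a, and the two summands are at most a t and X a.
head-bounded : ∀ {t} a {x p X} → 0 ℕ.< t → 0ℤ ℤ.≤ x → p ℤ.≤ + X →
  x * + t - p * + a ℤ.≤ + (a ℕ.* t) → x ℤ.≤ + (a ℕ.* t ℕ.+ X ℕ.* a)
head-bounded {suc t} a {+ x} {p} {X} _ _ p≤X y≤N = begin
  + x                                       ≤⟨ ℤ.+≤+ (ℕP.m≤m*n x (suc t)) ⟩
  + (x ℕ.* suc t)                           ≡⟨ ℤP.pos-* x (suc t) ⟩
  + x * + suc t                             ≡⟨ split (+ x * + suc t) (p * + a) ⟩
  + x * + suc t - p * + a + p * + a         ≤⟨ ℤP.+-mono-≤ y≤N (ℤP.*-monoʳ-≤-nonNeg (+ a) p≤X) ⟩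
  + (a ℕ.* suc t) + + X * + a               ≡⟨ cong (λ z → + (a ℕ.* suc t) + z) (ℤP.pos-* X a) ⟨
  + (a ℕ.* suc t ℕ.+ X ℕ.* a)               ∎
  where
  open ℤP.≤-Reasoning
  split : ∀ a b → a ≡ a - b + b
  split = solve-∀

W-nonNeg : ∀ {u s} → Positive s → (∀ N y → u N y ≢ 0ℤ → 0ℤ ℤ.≤ y) →
  ∀ {n t p} → 0 ℕ.< t → 0ℤ ℤ.≤ p → (v : Vec ℤ n) → W u s t p v ≢ 0ℤ → NonNeg v
W-nonNeg s>0 u-nonNeg 0<t 0≤p [] _ = []
W-nonNeg {u} {s} s>0 u-nonNeg {t = t} {p} 0<t 0≤p (x ∷ v) W≢0 = 0≤x ∷
  W-nonNeg (positive-∘suc s>0) u-nonNeg (s>0 1 ℕP.≤-refl) 0≤x v (*-≢0ʳ (u (s 1 ℕ.* t) (x * + t - p * + s 1)) W≢0)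
  where
  0≤x : 0ℤ ℤ.≤ x
  0≤x = head-nonNeg (s 1) {p = p} 0<t 0≤p (u-nonNeg _ _ (*-≢0ˡ W≢0))

wt : ∀ {n} → Vec ℤ n → ℤ
wt []      = 0ℤ
wt (x ∷ v) = x + wt v

-- The preceding coordinate p varies along the recursion, so the bound must be uniform in all p
-- between 0 and X; `head-bounded` supplies the next X.
W-bounded : ∀ {u s} → Positive s → (∀ N y → u N y ≢ 0ℤ → 0ℤ ℤ.≤ y × y ℤ.≤ + N) →
  ∀ {t} → 0 ℕ.< t → ∀ n X → ∃ λ M → ∀ {p} → 0ℤ ℤ.≤ p → p ℤ.≤ + X →
  (v : Vec ℤ n) → W u s t p v ≢ 0ℤ → wt v ℤ.≤ + M
W-bounded s>0 u-bounded 0<t zero X = 0 , λ _ _ → λ { [] _ → ℤP.≤-refl }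
W-bounded {u} {s} s>0 u-bounded {t} 0<t (suc n) X = X′ ℕ.+ M , bound
  where
  X′ : ℕ
  X′ = s 1 ℕ.* t ℕ.+ X ℕ.* s 1
  rec : ∃ λ M → ∀ {p} → 0ℤ ℤ.≤ p → p ℤ.≤ + X′ →
    (v : Vec ℤ n) → W u (s ∘ suc) (s 1) p v ≢ 0ℤ → wt v ℤ.≤ + M
  rec = W-bounded {u} (positive-∘suc s>0) u-bounded (s>0 1 ℕP.≤-refl) n X′
  M : ℕ
  M = proj₁ rec
  bound : ∀ {p} → 0ℤ ℤ.≤ p → p ℤ.≤ + X → (v : Vec ℤ (suc n)) → W u s t p v ≢ 0ℤ → wt v ℤ.≤ + (X′ ℕ.+ M)
  bound {p} 0≤p p≤X (x ∷ v) W≢0 = ℤP.+-mono-≤ x≤X′ (proj₂ rec 0≤x x≤X′ v (*-≢0ʳ (u (s 1 ℕ.* t) (x * + t - p * + s 1)) W≢0))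
    where
    y-bounds : 0ℤ ℤ.≤ x * + t - p * + s 1 × x * + t - p * + s 1 ℤ.≤ + (s 1 ℕ.* t)
    y-bounds = u-bounded _ _ (*-≢0ˡ W≢0)
    0≤x : 0ℤ ℤ.≤ x
    0≤x = head-nonNeg (s 1) {p = p} 0<t 0≤p (proj₁ y-bounds)
    x≤X′ : x ℤ.≤ + X′
    x≤X′ = head-bounded (s 1) 0<t 0≤x p≤X (proj₂ y-bounds)

ind≢0⇒ : {P : Set} (P? : Dec P) → ind P? ≢ 0ℤ → P
ind≢0⇒ (yes p) _   = p
ind≢0⇒ (no _)  0≢0 = contradiction refl 0≢0

[0≤]-nonNeg : ∀ N y → [0≤] N y ≢ 0ℤ → 0ℤ ℤ.≤ y
[0≤]-nonNeg N y = ind≢0⇒ (0ℤ ℤ.≤? y)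

[0<]-nonNeg : ∀ N y → [0<] N y ≢ 0ℤ → 0ℤ ℤ.≤ y
[0<]-nonNeg N y = ℤP.<⇒≤ ∘ ind≢0⇒ (0ℤ ℤ.<? y)

-- Both terms are 0 for negative y and both are 1 beyond N. The closed interval covers the two
-- half-open cases, 0 ≤ y < N for the cone and 0 < y ≤ N for the interior.
Δ-bounded : ∀ {u} → (∀ N y → u N y ≢ 0ℤ → 0ℤ ℤ.≤ y) → (∀ N y → 0ℤ ℤ.< y → u N y ≡ 1ℤ) →
  ∀ N y → Δ -1ℤ u N y ≢ 0ℤ → 0ℤ ℤ.≤ y × y ℤ.≤ + N
Δ-bounded {u} u-nonNeg u-one N y Δ≢0 with 0ℤ ℤ.≤? y | y ℤ.≤? + N
... | yes 0≤y | yes y≤N = 0≤y , y≤N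
... | no 0≰y  | _       = contradiction (cong₂ _-_ (u≡0 y 0≰y) (u≡0 (y + -1ℤ * + N) (0≰y ∘ below))) Δ≢0
  where
  u≡0 : ∀ z → ¬ (0ℤ ℤ.≤ z) → u N z ≡ 0ℤ
  u≡0 z = vanishes (u N z) (u-nonNeg N z)
  below : 0ℤ ℤ.≤ y + -1ℤ * + N → 0ℤ ℤ.≤ y
  below 0≤ = ℤP.≤-trans (ℤ.+≤+ z≤n) (ℤP.0≤i-j⇒j≤i (subst (λ z → 0ℤ ℤ.≤ y + z) (ℤP.-1*i≡-i (+ N)) 0≤))
... | yes 0≤y | no y≰N  = contradiction (cong₂ _-_ (u-one N y (ℤP.≤-<-trans (ℤ.+≤+ z≤n) N<y)) (u-one N (y + -1ℤ * + N) above)) Δ≢0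
  where
  N<y : + N ℤ.< y
  N<y = ℤP.≰⇒> y≰N
  above : 0ℤ ℤ.< y + -1ℤ * + N
  above = subst₂ ℤ._<_ (ℤP.+-inverseʳ (+ N)) (cong (λ z → y + z) (sym (ℤP.-1*i≡-i (+ N)))) (ℤP.+-monoˡ-< (- + N) N<y)

[0≤]-one : ∀ N y → 0ℤ ℤ.< y → [0≤] N y ≡ 1ℤ
[0≤]-one N y 0<y = ind-yes (0ℤ ℤ.≤? y) (ℤP.<⇒≤ 0<y)

[0<]-one : ∀ N y → 0ℤ ℤ.< y → [0<] N y ≡ 1ℤ
[0<]-one N y = ind-yes (0ℤ ℤ.<? y)

ind-× : {R P Q : Set} (R? : Dec R) (P? : Dec P) (Q? : Dec Q) →
  (R → P × Q) → (P → Q → R) → ind R? ≡ ind P? * ind Q?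
ind-× R? (no ¬p) Q?      f g = ind-no R? (¬p ∘ proj₁ ∘ f)
ind-× R? (yes _) (no ¬q) f g = ind-no R? (¬q ∘ proj₂ ∘ f)
ind-× R? (yes p) (yes q) f g = ind-yes R? (g p q)

∑-cong-All : {A : Set} {f g : A → ℤ} {xs : List A} → All (λ x → f x ≡ g x) xs → ∑ xs f ≡ ∑ xs g
∑-cong-All []       = refl
∑-cong-All (p ∷ ps) = cong₂ _+_ p (∑-cong-All ps)

∑-upTo-pick : ∀ (f : ℕ → ℤ) x {m} → x ℕ.< m → ∑ (upTo m) (λ k → ind (x ℕ.≟ k) * f k) ≡ f x
∑-upTo-miss : ∀ (f : ℕ → ℤ) x {m} → m ℕ.≤ x → ∑ (upTo m) (λ k → ind (x ℕ.≟ k) * f k) ≡ 0ℤ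
∑-upTo-miss f x {m} m≤x = ∑-zero (All.map (λ {k} k<m →
  cong (_* f k) (ind-no (x ℕ.≟ k) λ { refl → ℕP.<⇒≱ k<m m≤x })) (AllP.all-upTo m))
∑-upTo-pick f x {suc m} x<1+m = begin
  ∑ (upTo (suc m)) h                ≡⟨ cong (λ l → ∑ l h) (ListP.upTo-∷ʳ m) ⟨
  ∑ (upTo m ++ m ∷ []) h            ≡⟨ ∑-++ h (upTo m) (m ∷ []) ⟩
  ∑ (upTo m) h + (h m + 0ℤ)         ≡⟨ cong (λ z → ∑ (upTo m) h + z) (ℤP.+-identityʳ (h m)) ⟩
  ∑ (upTo m) h + h m                ≡⟨ last ⟩
  f x                               ∎
  where
  open ≡-Reasoning
  h : ℕ → ℤ
  h k = ind (x ℕ.≟ k) * f k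
  last : ∑ (upTo m) h + h m ≡ f x
  last with x ℕ.≟ m
  ... | yes refl = trans (cong₂ _+_ (∑-upTo-miss f x ℕP.≤-refl) (ℤP.*-identityˡ (f x))) (ℤP.+-identityˡ (f x))
  ... | no x≢m   = trans (ℤP.+-identityʳ _) (∑-upTo-pick f x (ℕP.≤∧≢⇒< (ℕ.s≤s⁻¹ x<1+m) x≢m))

-- Total degree and the enumeration of compositions

wt-⊕ : ∀ {n} (u v : Vec ℤ n) → wt (zipWith _+_ u v) ≡ wt u + wt v
wt-⊕ []      []      = refl
wt-⊕ (x ∷ u) (y ∷ v) = trans (cong (λ z → x + y + z) (wt-⊕ u v)) (interchange x y (wt u) (wt v))
  where
  interchange : ∀ a b c d → a + b + (c + d) ≡ a + c + (b + d)
  interchange = solve-∀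

wt-⊖ : ∀ {n} (v : Vec ℤ n) → wt (Vec.map neg v) ≡ - wt v
wt-⊖ []      = refl
wt-⊖ (x ∷ v) = trans (cong (λ z → - x + z) (wt-⊖ v)) (sym (ℤP.neg-distrib-+ x (wt v)))

wt-⊝ : ∀ {n} (u v : Vec ℤ n) → wt (V._⊝_ n u v) ≡ wt u - wt v
wt-⊝ u v = trans (wt-⊕ u _) (cong (λ z → wt u + z) (wt-⊖ v))

wt-𝟘 : ∀ n → wt (replicate n 0ℤ) ≡ 0ℤ
wt-𝟘 zero    = refl
wt-𝟘 (suc n) = trans (ℤP.+-identityˡ _) (wt-𝟘 n)

wt-nonNeg : ∀ {n} {v : Vec ℤ n} → NonNeg v → 0ℤ ℤ.≤ wt v
wt-nonNeg []       = ℤP.≤-refl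
wt-nonNeg (p ∷ ps) = ℤP.+-mono-≤ p (wt-nonNeg ps)

emb-nonNeg : ∀ {n} (b : Fin n → ℕ) → NonNeg (emb b)
emb-nonNeg {zero}  b = []
emb-nonNeg {suc n} b = ℤ.+≤+ z≤n ∷ emb-nonNeg (b ∘ suc)

nonNeg-emb : ∀ {n} {v : Vec ℤ n} → NonNeg v → ∃ λ a → v ≡ emb a
nonNeg-emb []                     = (λ ()) , refl
nonNeg-emb (ℤ.+≤+ {n = k} _ ∷ ps) = k ∷v proj₁ (nonNeg-emb ps) , cong (+ k ∷_) (proj₂ (nonNeg-emb ps))

_≟v_ : ∀ {n} (u v : Vec ℤ n) → Dec (u ≡ v)
_≟v_ = VecP.≡-dec ℤ._≟_

compositions : ∀ n → ℤ → List (Fin n → ℕ)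
compositions n (+ d)    = comps n d
compositions n -[1+ _ ] = []

comps-wt : ∀ n d → All (λ w → wt (emb w) ≡ + d) (comps n d)
comps-wt zero    zero    = refl ∷ []
comps-wt zero    (suc d) = []
comps-wt (suc n) d = AllP.concat⁺ (AllP.map⁺ (All.map (λ {k} k≤d →
  AllP.map⁺ (All.map (λ eq → trans (cong (λ z → + k + z) eq) (cong +_ (ℕP.m+[n∸m]≡n (ℕ.s≤s⁻¹ k≤d))))
    (comps-wt n (d ℕ.∸ k)))) (AllP.all-upTo (suc d))))

compositions-wt : ∀ n e → All (λ w → wt (emb w) ≡ e) (compositions n e)
compositions-wt n (+ d)    = comps-wt n d
compositions-wt n -[1+ _ ] = []

-- Completeness of the enumeration and absence of repetitions in one equation. The index k of `upTo`
-- singles out the first entry of `a`; if that entry exceeds d, both sides vanish.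
comps-count : ∀ {n} (a : Fin n → ℕ) d → ∑ (comps n d) (λ w → ind (emb a ≟v emb w)) ≡ ind (wt (emb a) ℤ.≟ + d)
comps-count {zero}  a zero    = refl
comps-count {zero}  a (suc d) = refl
comps-count {suc n} a d = begin
  ∑ (comps (suc n) d) (λ w → ind (emb a ≟v emb w))
    ≡⟨ ∑-concatMap _ (λ k → map (k ∷v_) (comps n (d ℕ.∸ k))) (upTo (suc d)) ⟩
  ∑ (upTo (suc d)) (λ k → ∑ (map (k ∷v_) (comps n (d ℕ.∸ k))) (λ w → ind (emb a ≟v emb w)))
    ≡⟨ ∑-cong (upTo (suc d)) (λ k → trans (∑-map _ (k ∷v_) (comps n (d ℕ.∸ k)))
         (trans (∑-cong (comps n (d ℕ.∸ k)) (split k)) (trans (*-distribˡ-∑ (ind (a zero ℕ.≟ k)) _ (comps n (d ℕ.∸ k)))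
           (cong (ind (a zero ℕ.≟ k) *_) (comps-count (a ∘ suc) (d ℕ.∸ k)))))) ⟩
  ∑ (upTo (suc d)) (λ k → ind (a zero ℕ.≟ k) * ind (wt (emb (a ∘ suc)) ℤ.≟ + (d ℕ.∸ k)))
    ≡⟨ total ⟩
  ind (wt (emb a) ℤ.≟ + d) ∎
  where
  open ≡-Reasoning
  split : ∀ k w → ind (emb a ≟v emb (k ∷v w)) ≡ ind (a zero ℕ.≟ k) * ind (emb (a ∘ suc) ≟v emb w)
  split k w = ind-× (emb a ≟v emb (k ∷v w)) (a zero ℕ.≟ k) (emb (a ∘ suc) ≟v emb w)
    (λ eq → ℤP.+-injective (VecP.∷-injectiveˡ eq) , VecP.∷-injectiveʳ eq)
    (λ { refl → cong (λ z → + a zero ∷ z) })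
  total : ∑ (upTo (suc d)) (λ k → ind (a zero ℕ.≟ k) * ind (wt (emb (a ∘ suc)) ℤ.≟ + (d ℕ.∸ k))) ≡ ind (wt (emb a) ℤ.≟ + d)
  total with a zero ℕ.≤? d
  ... | yes a₀≤d = trans (∑-upTo-pick (λ k → ind (wt (emb (a ∘ suc)) ℤ.≟ + (d ℕ.∸ k))) (a zero) (s≤s a₀≤d)) (ind-cong (wt (emb (a ∘ suc)) ℤ.≟ + (d ℕ.∸ a zero)) (wt (emb a) ℤ.≟ + d)
      (λ eq → trans (cong (λ z → + a zero + z) eq) whole)
      (λ eq → ℤG.∙-cancelˡ (+ a zero) _ _ (trans eq (sym whole))))
    where
    whole : + a zero + + (d ℕ.∸ a zero) ≡ + d
    whole = cong +_ (ℕP.m+[n∸m]≡n a₀≤d)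
  ... | no a₀≰d = trans (∑-upTo-miss _ (a zero) (ℕP.≰⇒> a₀≰d)) (sym (ind-no (wt (emb a) ℤ.≟ + d)
      λ eq → a₀≰d (ℤP.drop‿+≤+ (subst (+ a zero ℤ.≤_) eq
        (ℤP.≤-trans (ℤP.≤-reflexive (sym (ℤP.+-identityʳ (+ a zero)))) (ℤP.+-monoʳ-≤ (+ a zero) (wt-nonNeg (emb-nonNeg (a ∘ suc)))))))))

compositions-count : ∀ {n} {v : Vec ℤ n} → NonNeg v → ∀ e →
  ∑ (compositions n e) (λ w → ind (v ≟v emb w)) ≡ ind (wt v ℤ.≟ e)
compositions-count {v = v} 0≤v e with nonNeg-emb 0≤v
compositions-count {v = v} 0≤v (+ d)    | a , refl = comps-count a d
compositions-count {v = v} 0≤v -[1+ d ] | a , refl =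
  sym (ind-no (wt (emb a) ℤ.≟ -[1+ d ]) λ eq → ℤP.<⇒≱ ℤ.-<+ (subst (0ℤ ℤ.≤_) eq (wt-nonNeg 0≤v)))

emb-⊕ : ∀ {n} (a b : Fin n → ℕ) → zipWith _+_ (emb a) (emb b) ≡ emb (λ i → a i ℕ.+ b i)
emb-⊕ {zero}  a b = refl
emb-⊕ {suc n} a b = cong (λ z → + (a zero ℕ.+ b zero) ∷ z) (emb-⊕ (a ∘ suc) (b ∘ suc))

emb-0 : ∀ n → replicate n 0ℤ ≡ emb {n} (λ _ → 0)
emb-0 zero    = refl
emb-0 (suc n) = cong (0ℤ ∷_) (emb-0 n)

-- Specialization to the total degree

module _ {n : ℕ} where
  open V n

  lift : MPoly n → Poly
  lift = map (map₁ emb)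

  weigh : Poly → U.Poly
  weigh = map (map₁ wt)

  NonNegSupported : Series → Set
  NonNegSupported H = ∀ v → H v ≢ 0ℤ → NonNeg v

  -- The substitution of q for every variable. Only exponents in the orthant are summed, which keeps
  -- the sums finite and is faithful for `NonNegSupported` series.
  push : Series → U.Series
  push H e = ∑ (compositions n e) (H ∘ emb)

  ind-subst : ∀ (H : Series) u v → ind (u ≟v v) * H v ≡ H u * ind (u ≟v v)
  ind-subst H u v with u ≟v v
  ... | yes refl = ℤP.*-comm 1ℤ (H u)
  ... | no _     = sym (ℤP.*-zeroʳ (H u))

  -- Outside the orthant v need not be listed, but there H v = 0 and the sum vanishes as well.
  sift : ∀ {H} → NonNegSupported H → ∀ v e → wt v ≡ e →
    H v ≡ ∑ (compositions n e) (λ w → ind (v ≟v emb w) * H (emb w))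
  sift {H} suppH v e wt≡ = sym (trans
    (trans (∑-cong (compositions n e) (λ w → ind-subst H v (emb w))) (*-distribˡ-∑ (H v) _ (compositions n e)))
    count)
    where
    count : H v * ∑ (compositions n e) (λ w → ind (v ≟v emb w)) ≡ H v
    count with H v ℤ.≟ 0ℤ
    ... | yes Hv≡0 rewrite Hv≡0 = refl
    ... | no Hv≢0 = trans (cong (H v *_) (trans (compositions-count (suppH v Hv≢0) e) (ind-yes (wt v ℤ.≟ e) wt≡)))
                      (ℤP.*-identityʳ (H v))

  -- Double counting of the pairs (v, w) with v = w + b.
  push-shift : ∀ {H} → NonNegSupported H → ∀ b e →
    push (λ v → H (v ⊝ emb b)) e ≡ push H (e - wt (emb b))
  push-shift {H} suppH b e = begin
    ∑ C (λ v → H (emb v ⊝ emb b))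
      ≡⟨ ∑-cong-All (All.map (λ {v} eq → sift suppH (emb v ⊝ emb b) e′ (trans (wt-⊝ (emb v) (emb b))
           (cong (_- wt (emb b)) eq))) (compositions-wt n e)) ⟩
    ∑ C (λ v → ∑ C′ (λ w → ind ((emb v ⊝ emb b) ≟v emb w) * H (emb w)))
      ≡⟨ ∑-comm _ C C′ ⟩
    ∑ C′ (λ w → ∑ C (λ v → ind ((emb v ⊝ emb b) ≟v emb w) * H (emb w)))
      ≡⟨ ∑-cong-All (All.map (λ {w} eq → fibre w eq) (compositions-wt n e′)) ⟩
    ∑ C′ (H ∘ emb) ∎
    where
    open ≡-Reasoning
    e′ : ℤ
    e′ = e - wt (emb b)
    C C′ : List (Fin n → ℕ)
    C = compositions n e
    C′ = compositions n e′
    flip-shift : ∀ v w → ind ((emb v ⊝ emb b) ≟v emb w) ≡ ind ((emb w ⊕ emb b) ≟v emb v)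
    flip-shift v w = ind-cong ((emb v ⊝ emb b) ≟v emb w) ((emb w ⊕ emb b) ≟v emb v)
      (λ eq → trans (cong (_⊕ emb b) (sym eq)) (⊝-⊕ (emb v) (emb b)))
      (λ eq → trans (cong (_⊝ emb b) (sym eq)) (⊕-⊝ (emb w) (emb b)))
    restore : ∀ e b → e - b + b ≡ e
    restore = solve-∀
    fibre : ∀ w → wt (emb w) ≡ e′ → ∑ C (λ v → ind ((emb v ⊝ emb b) ≟v emb w) * H (emb w)) ≡ H (emb w)
    fibre w eq = begin
      ∑ C (λ v → ind ((emb v ⊝ emb b) ≟v emb w) * H (emb w))
        ≡⟨ ∑-cong C (λ v → trans (cong (_* H (emb w)) (flip-shift v w)) (ℤP.*-comm _ (H (emb w)))) ⟩
      ∑ C (λ v → H (emb w) * ind ((emb w ⊕ emb b) ≟v emb v))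
        ≡⟨ *-distribˡ-∑ (H (emb w)) _ C ⟩
      H (emb w) * ∑ C (λ v → ind ((emb w ⊕ emb b) ≟v emb v))
        ≡⟨ cong (H (emb w) *_) (compositions-count (subst NonNeg (sym (emb-⊕ w b)) (emb-nonNeg _)) e) ⟩
      H (emb w) * ind (wt (emb w ⊕ emb b) ℤ.≟ e)
        ≡⟨ cong (H (emb w) *_) (ind-yes (wt (emb w ⊕ emb b) ℤ.≟ e)
             (trans (wt-⊕ (emb w) (emb b)) (trans (cong (_+ wt (emb b)) eq) (restore e (wt (emb b)))))) ⟩
      H (emb w) * 1ℤ
        ≡⟨ ℤP.*-identityʳ (H (emb w)) ⟩
      H (emb w) ∎

  push-cong : ∀ {H K} → (∀ v → H v ≡ K v) → ∀ e → push H e ≡ push K e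
  push-cong H≗K e = ∑-cong (compositions n e) (λ w → H≗K (emb w))

  push-· : ∀ A {H} → NonNegSupported H → ∀ e → push (lift A · H) e ≡ (weigh (lift A) U.· push H) e
  push-· A {H} suppH e = begin
    ∑ C (λ v → (lift A · H) (emb v))
      ≡⟨ ∑-cong C (λ v → ∑-map _ (map₁ emb) A) ⟩
    ∑ C (λ v → ∑ A (λ { (b , c) → c * H (emb v ⊝ emb b) }))
      ≡⟨ ∑-comm _ C A ⟩
    ∑ A (λ x → ∑ C (λ v → proj₂ x * H (emb v ⊝ emb (proj₁ x))))
      ≡⟨ ∑-cong A (λ { (b , c) → trans (*-distribˡ-∑ c _ C) (cong (c *_) (push-shift suppH b e)) }) ⟩
    ∑ A (λ { (b , c) → c * push H (e - wt (emb b)) })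
      ≡⟨ ∑-map _ (map₁ emb) A ⟨
    ∑ (lift A) (λ { (a , c) → c * push H (e - wt a) })
      ≡⟨ ∑-map _ (map₁ wt) (lift A) ⟨
    (weigh (lift A) U.· push H) e ∎
    where
    open ≡-Reasoning
    C : List (Fin n → ℕ)
    C = compositions n e

  δ-supported : NonNegSupported δ
  δ-supported v δ≢0 = subst NonNeg (trans (sym (emb-0 n)) (ind≢0⇒ (𝟘 ≟v v) δ≢0)) (emb-nonNeg (λ _ → 0))

  push-δ : ∀ e → push δ e ≡ U.δ e
  push-δ e = trans (compositions-count (subst NonNeg (sym (emb-0 n)) (emb-nonNeg {n} (λ _ → 0))) e)
    (cong (λ z → ind (z ℤ.≟ e)) (wt-𝟘 n))

  -- On series constant in each degree, `A` acts through its specialization. Unlike `push`, this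
  -- pullback also handles negative exponents, hence reflected polynomials.
  weigh-· : ∀ A K v → (A · (K ∘ wt)) v ≡ (weigh A U.· K) (wt v)
  weigh-· A K v = trans (∑-cong A (λ { (a , c) → cong (λ z → c * K z) (wt-⊝ v a) })) (sym (∑-map _ (map₁ wt) A))

  weigh-·-· : ∀ A B v → (A · B · (U.δ ∘ wt)) v ≡ (weigh A U.· weigh B U.· U.δ) (wt v)
  weigh-·-· A B v = trans (·-cong A (weigh-· B U.δ) v) (weigh-· A (weigh B U.· U.δ) v)

  weigh-inv : ∀ A → weigh (inv A) ≡ U.inv (weigh A)
  weigh-inv A = trans (sym (ListP.map-∘ A)) (trans
    (ListP.map-cong (λ { (a , c) → cong (_, c) (wt-⊖ a) }) A) (ListP.map-∘ A))

  tabulated : Series → ℕ → MPoly n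
  tabulated H M = concatMap (λ d → map (λ w → w , H (emb w)) (comps n d)) (upTo (suc M))

  -- In the orthant a bound on the total degree leaves finitely many exponents, so the compositions
  -- of 0,...,M exhaust the support.
  tabulated-δ : ∀ {H} M → NonNegSupported H → (∀ v → H v ≢ 0ℤ → wt v ℤ.≤ + M) →
    ∀ v → (lift (tabulated H M) · δ) v ≡ H v
  tabulated-δ {H} M suppH bounded v = begin
    (lift (tabulated H M) · δ) v
      ≡⟨ ∑-map _ (map₁ emb) (tabulated H M) ⟩
    ∑ (tabulated H M) (λ { (w , c) → c * δ (v ⊝ emb w) })
      ≡⟨ ∑-concatMap (λ { (w , c) → c * δ (v ⊝ emb w) }) (λ d → map (λ w → w , H (emb w)) (comps n d)) (upTo (suc M)) ⟩
    ∑ (upTo (suc M)) (λ d → ∑ (map (λ w → w , H (emb w)) (comps n d)) (λ { (w , c) → c * δ (v ⊝ emb w) }))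
      ≡⟨ ∑-cong (upTo (suc M)) (λ d → trans (∑-map _ _ (comps n d)) (trans
           (∑-cong (comps n d) (λ w → term w)) (*-distribˡ-∑ (H v) _ (comps n d)))) ⟩
    ∑ (upTo (suc M)) (λ d → H v * ∑ (comps n d) (λ w → ind (v ≟v emb w)))
      ≡⟨ *-distribˡ-∑ (H v) _ (upTo (suc M)) ⟩
    H v * ∑ (upTo (suc M)) (λ d → ∑ (comps n d) (λ w → ind (v ≟v emb w)))
      ≡⟨ total ⟩
    H v ∎
    where
    open ≡-Reasoning
    term : ∀ w → H (emb w) * δ (v ⊝ emb w) ≡ H v * ind (v ≟v emb w)
    term w = trans (ℤP.*-comm (H (emb w)) _) (trans (cong (_* H (emb w))
      (ind-cong (𝟘 ≟v (v ⊝ emb w)) (v ≟v emb w) ⊝≡𝟘⇒≡ ≡⇒⊝≡𝟘)) (ind-subst H v (emb w)))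
    total : H v * ∑ (upTo (suc M)) (λ d → ∑ (comps n d) (λ w → ind (v ≟v emb w))) ≡ H v
    total with H v ℤ.≟ 0ℤ
    ... | yes Hv≡0 rewrite Hv≡0 = refl
    ... | no Hv≢0 = trans (cong (H v *_) (trans
        (∑-cong (upTo (suc M)) (λ d → trans (compositions-count (suppH v Hv≢0) (+ d)) (recast d)))
        (∑-upTo-pick (λ _ → 1ℤ) ℤ.∣ wt v ∣ (s≤s (ℤP.drop‿+≤+ (subst (ℤ._≤ + M) (sym wt≡) (bounded v Hv≢0)))))))
        (ℤP.*-identityʳ (H v))
      where
      wt≡ : + ℤ.∣ wt v ∣ ≡ wt v
      wt≡ = ℤP.0≤i⇒+∣i∣≡i (wt-nonNeg (suppH v Hv≢0))
      recast : ∀ d → ind (wt v ℤ.≟ + d) ≡ ind (ℤ.∣ wt v ∣ ℕ.≟ d) * 1ℤ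
      recast d = trans (ind-cong (wt v ℤ.≟ + d) (ℤ.∣ wt v ∣ ℕ.≟ d)
        (λ eq → ℤP.+-injective (trans wt≡ eq)) (λ eq → trans (sym wt≡) (cong +_ eq))) (sym (ℤP.*-identityʳ _))

∑≢0 : {A : Set} {f : A → ℤ} (xs : List A) → ∑ xs f ≢ 0ℤ → ∃ λ x → x ∈ xs × f x ≢ 0ℤ
∑≢0         []       0≢0 = contradiction refl 0≢0
∑≢0 {f = f} (x ∷ xs) ≢0  with f x ℤ.≟ 0ℤ
... | no fx≢0  = x , here refl , fx≢0
... | yes fx≡0 = map₂ (map₁ there) (∑≢0 xs (≢0 ∘ λ eq → cong₂ _+_ fx≡0 eq))

-- Cone membership as a chain of inequalities

Chain : (ℤ → Set) → (ℕ → ℕ) → ∀ {n} → ℕ → ℤ → Vec ℤ n → Set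
Chain R s t p []      = ⊤
Chain R s t p (x ∷ v) = R (x * + t - p * + s 1) × Chain R (s ∘ suc) (s 1) x v

chain⇒W≡1 : ∀ {R u} → (∀ N y → R y → u N y ≡ 1ℤ) →
  ∀ s {n} t p (v : Vec ℤ n) → Chain R s t p v → W u s t p v ≡ 1ℤ
chain⇒W≡1 one s t p []      _       = refl
chain⇒W≡1 one s t p (x ∷ v) (r , c) = cong₂ _*_ (one _ _ r) (chain⇒W≡1 one (s ∘ suc) (s 1) x v c)

W≢0⇒chain : ∀ {R u} → (∀ N y → u N y ≢ 0ℤ → R y) →
  ∀ s {n} t p (v : Vec ℤ n) → W u s t p v ≢ 0ℤ → Chain R s t p v
W≢0⇒chain nz s t p [] _ = tt
W≢0⇒chain {u = u} nz s t p (x ∷ v) W≢0 =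
  nz _ _ (*-≢0ˡ W≢0) , W≢0⇒chain nz (s ∘ suc) (s 1) x v (*-≢0ʳ (u (s 1 ℕ.* t) (x * + t - p * + s 1)) W≢0)

module _ {_R₂_ : ℤ → ℤ → Set} {R : ℤ → Set}
  (to : ∀ {a b} → a R₂ b → R (b - a)) (from : ∀ {a b} → R (b - a) → a R₂ b) where

  head-shape : ∀ x a → x * 1ℤ - 0ℤ * + a ≡ x - 0ℤ
  head-shape x a = cong (_- 0ℤ) (ℤP.*-identityʳ x)

  -- The steps at successor indices shift definitionally with the sequence, whereas step zero has
  -- its own shape; the recursion therefore runs over the former only.
  tail⇒chain : ∀ s n (l : Fin (suc n) → ℤ) → (∀ j → Step _R₂_ s l (suc j)) →
    Chain R (s ∘ suc) (s 1) (l zero) (tabulate (l ∘ suc))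
  tail⇒chain s zero    l step = tt
  tail⇒chain s (suc n) l step = to (step zero) , tail⇒chain (s ∘ suc) n (l ∘ suc) (step ∘ suc)

  chain⇒tail : ∀ s n (l : Fin (suc n) → ℤ) → Chain R (s ∘ suc) (s 1) (l zero) (tabulate (l ∘ suc)) →
    ∀ j → Step _R₂_ s l (suc j)
  chain⇒tail s (suc n) l (r , c) zero    = from r
  chain⇒tail s (suc n) l (r , c) (suc j) = chain⇒tail (s ∘ suc) n (l ∘ suc) c j

  steps⇒chain : ∀ s n (l : Fin n → ℤ) → (∀ i → Step _R₂_ s l i) → Chain R s 1 0ℤ (tabulate l)
  steps⇒chain s zero    l step = tt
  steps⇒chain s (suc n) l step =
    subst R (sym (head-shape (l zero) (s 1))) (to (step zero)) , tail⇒chain s n l (step ∘ suc)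

  chain⇒steps : ∀ s n (l : Fin n → ℤ) → Chain R s 1 0ℤ (tabulate l) → ∀ i → Step _R₂_ s l i
  chain⇒steps s (suc n) l (r , c) zero    = from (subst R (head-shape (l zero) (s 1)) r)
  chain⇒steps s (suc n) l (r , c) (suc j) = chain⇒tail s n l c j

i<j⇒0<j-i : ∀ {i j} → i ℤ.< j → 0ℤ ℤ.< j - i
i<j⇒0<j-i {i} {j} i<j = subst (ℤ._< j - i) (ℤP.+-inverseʳ i) (ℤP.+-monoˡ-< (- i) i<j)

0<j-i⇒i<j : ∀ {i j} → 0ℤ ℤ.< j - i → i ℤ.< j
0<j-i⇒i<j {i} {j} 0<j-i = subst₂ ℤ._<_ (ℤP.+-identityˡ i) (restore j i) (ℤP.+-monoˡ-< i 0<j-i)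
  where
  restore : ∀ j i → j - i + i ≡ j
  restore = solve-∀

W-𝟘 : ∀ {u} → (∀ N → 0 ℕ.< N → u N 0ℤ ≡ 1ℤ) → ∀ {s} → Positive s →
  ∀ n {t} → 0 ℕ.< t → W u s t 0ℤ (replicate n 0ℤ) ≡ 1ℤ
W-𝟘 one s>0 zero    0<t = refl
W-𝟘 {u} one {s} s>0 (suc n) {t} 0<t = cong₂ _*_
  (one (s 1 ℕ.* t) (ℕP.*-mono-≤ (s>0 1 ℕP.≤-refl) 0<t))
  (W-𝟘 one (positive-∘suc s>0) n (s>0 1 ℕP.≤-refl))

-- Natural-number exponents and the series formalism

nonNeg-⊝ : ∀ {n} (v : Vec ℤ n) b → NonNeg (V._⊝_ n v (emb b)) → NonNeg v
nonNeg-⊝ []      b []       = []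
nonNeg-⊝ (x ∷ v) b (p ∷ ps) = ℤP.≤-trans (ℤ.+≤+ z≤n) (ℤP.0≤i-j⇒j≤i {x} {+ b zero} p) ∷ nonNeg-⊝ v (b ∘ suc) ps

emb-∸ : ∀ {n} (a b : Fin n → ℕ) → (∀ i → b i ℕ.≤ a i) → emb (λ i → a i ℕ.∸ b i) ≡ V._⊝_ n (emb a) (emb b)
emb-∸ {zero}  a b b≤a = refl
emb-∸ {suc n} a b b≤a = cong₂ _∷_
  (trans (sym (ℤP.⊖-≥ (b≤a zero))) (sym (ℤP.m-n≡m⊖n (a zero) (b zero))))
  (emb-∸ (a ∘ suc) (b ∘ suc) (b≤a ∘ suc))

nonNeg-⊝⇒≤ : ∀ {n} (a b : Fin n → ℕ) → NonNeg (V._⊝_ n (emb a) (emb b)) → ∀ i → b i ℕ.≤ a i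
nonNeg-⊝⇒≤ a b (p ∷ ps) zero    = ℤP.drop‿+≤+ (ℤP.0≤i-j⇒j≤i p)
nonNeg-⊝⇒≤ a b (p ∷ ps) (suc i) = nonNeg-⊝⇒≤ (a ∘ suc) (b ∘ suc) ps i

module _ {n : ℕ} where
  open V n

  tabulate-injective : ∀ {A : Set} {f h : Fin n → A} → tabulate f ≡ tabulate h → ∀ i → f i ≡ h i
  tabulate-injective {f = f} {h} eq i = trans (sym (VecP.lookup∘tabulate f i))
    (trans (cong (λ v → lookup v i) eq) (VecP.lookup∘tabulate h i))

  mcoef-δ : ∀ P a → mcoef P a ≡ (lift P · δ) (emb a)
  mcoef-δ P a = trans
    (∑-cong P (λ { (b , c) → trans (ℤP.*-comm _ c) (cong (c *_) (ind-cong (PtEq? ℕP._≟_ b a) (𝟘 ≟v (emb a ⊝ emb b))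
      (λ b≡a → ≡⇒⊝≡𝟘 (VecP.tabulate-cong (λ i → cong +_ (sym (b≡a i)))))
      (λ eq i → ℤP.+-injective (tabulate-injective (sym (⊝≡𝟘⇒≡ eq)) i)))) }))
    (sym (∑-map _ (map₁ emb) P))

  laurCoef-laur : ∀ m A B e → laurCoef m A B e ≡ laur (tabulate m) (lift A) (lift B) (tabulate e)
  laurCoef-laur m A B e = trans
    (∑-cong A (λ { (α , c) → trans
      (∑-cong B (λ { (β , d) → cong (_* (c * d)) (ind-cong
        (PtEq? ℤ._≟_ (λ i → m i - + α i + + β i) e) (((tabulate m ⊝ emb α) ⊕ emb β) ≟v tabulate e)
        (λ eq → trans (shape m α β) (VecP.tabulate-cong eq))
        (λ eq → tabulate-injective (trans (sym (shape m α β)) eq))) }))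
      (sym (∑-map _ (map₁ emb) B)) }))
    (sym (∑-map _ (map₁ emb) A))
    where
    shape : ∀ {n} (m : Fin n → ℤ) (α β : Fin n → ℕ) →
      V._⊕_ n (V._⊝_ n (tabulate m) (emb α)) (emb β) ≡ tabulate (λ i → m i - + α i + + β i)
    shape {zero}  m α β = refl
    shape {suc n} m α β = cong (λ z → m zero - + α zero + + β zero ∷ z) (shape (m ∘ suc) (α ∘ suc) (β ∘ suc))

  lift-supported : ∀ A {H} → NonNegSupported {n} H → NonNegSupported {n} (lift A · H)
  lift-supported A {H} suppH v ≢0 with ∑≢0 A (≢0 ∘ trans (∑-map _ (map₁ emb) A))
  ... | (b , c) , _ , cH≢0 = nonNeg-⊝ v b (suppH (v ⊝ emb b) (*-≢0ʳ c cH≢0))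

  nonzero⇒MNonzero : ∀ A → Nonzero (lift A) → MNonzero A
  nonzero⇒MNonzero A (v , ≢0) with nonNeg-emb (lift-supported A δ-supported v ≢0)
  ... | a , refl = a , ≢0 ∘ trans (sym (mcoef-δ A a))

  MNonzero⇒nonzero : ∀ A → MNonzero A → Nonzero (lift A)
  MNonzero⇒nonzero A (a , ≢0) = emb a , ≢0 ∘ trans (mcoef-δ A a)

  -- Identities given on ℕⁿ, as in `RepG`, extend to ℤⁿ because both sides vanish off the orthant.
  supported-ext : ∀ {H K} → NonNegSupported {n} H → NonNegSupported {n} K →
    (∀ a → H (emb a) ≡ K (emb a)) → ∀ v → H v ≡ K v
  supported-ext {H} {K} suppH suppK H≗K v with H v ℤ.≟ 0ℤ | K v ℤ.≟ 0ℤ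
  ... | yes Hv≡0 | yes Kv≡0 = trans Hv≡0 (sym Kv≡0)
  ... | no Hv≢0  | _        with nonNeg-emb (suppH v Hv≢0)
  ...   | a , refl = H≗K a
  supported-ext {H} {K} suppH suppK H≗K v | yes _ | no Kv≢0 with nonNeg-emb (suppK v Kv≢0)
  ...   | a , refl = H≗K a

  bounded-nonNeg : ∀ {H} → NonNegSupported {n} H → Bounded H
  bounded-nonNeg {H} supp = 𝟘 , λ v → vanishes (H v) (supp v)

∣wt∣ : ∀ {n} → (Fin n → ℕ) → ℕ
∣wt∣ b = ℤ.∣ wt (emb b) ∣

ulift : UPoly → U.Poly
ulift = map (map₁ pos)

total-degree : ∀ {n} → MPoly n → UPoly
total-degree = map (map₁ ∣wt∣)

ulift-total-degree : ∀ {n} (A : MPoly n) → ulift (total-degree A) ≡ weigh (lift A)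
ulift-total-degree A = trans (sym (ListP.map-∘ A)) (trans
  (ListP.map-cong (λ { (b , c) → cong (_, c) (ℤP.0≤i⇒+∣i∣≡i (wt-nonNeg (emb-nonNeg b))) }) A) (ListP.map-∘ A))

ucoef-δ : ∀ P a → ucoef P a ≡ (ulift P U.· U.δ) (+ a)
ucoef-δ P a = trans
  (∑-cong P (λ { (b , c) → trans (ℤP.*-comm _ c) (cong (c *_) (ind-cong (b ℕP.≟ a) (0ℤ ℤ.≟ (+ a - + b))
    (λ { refl → sym (ℤP.+-inverseʳ (+ b)) })
    (λ eq → ℤP.+-injective (sym (U.⊝≡𝟘⇒≡ eq))))) }))
  (sym (∑-map _ (map₁ pos) P))

ulaurCoef-laur : ∀ k A B e → ulaurCoef k A B e ≡ U.laur k (ulift A) (ulift B) e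
ulaurCoef-laur k A B e = trans
  (∑-cong A (λ { (α , c) → sym (∑-map _ (map₁ pos) B) }))
  (sym (∑-map _ (map₁ pos) A))

0≤i-+⇒0≤i : ∀ i k → 0ℤ ℤ.≤ i - + k → 0ℤ ℤ.≤ i
0≤i-+⇒0≤i i k p = ℤP.≤-trans (ℤ.+≤+ z≤n) (ℤP.0≤i-j⇒j≤i {i} {+ k} p)

ulift-supported : ∀ A {H} → (∀ e → H e ≢ 0ℤ → 0ℤ ℤ.≤ e) → ∀ e → (ulift A U.· H) e ≢ 0ℤ → 0ℤ ℤ.≤ e
ulift-supported A {H} suppH e ≢0 with ∑≢0 A (≢0 ∘ trans (∑-map _ (map₁ pos) A))
... | (b , c) , _ , cH≢0 = 0≤i-+⇒0≤i e b (suppH (e - + b) (*-≢0ʳ c cH≢0))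

U-δ-supported : ∀ e → U.δ e ≢ 0ℤ → 0ℤ ℤ.≤ e
U-δ-supported e ≢0 = ℤP.≤-reflexive (ind≢0⇒ (0ℤ ℤ.≟ e) ≢0)

nonzero⇒UNonzero : ∀ A → U.Nonzero (ulift A) → UNonzero A
nonzero⇒UNonzero A (e , ≢0) with ulift-supported A U-δ-supported e ≢0
... | ℤ.+≤+ {n = a} _ = a , ≢0 ∘ trans (sym (ucoef-δ A a))

UNonzero⇒nonzero : ∀ A → UNonzero A → U.Nonzero (ulift A)
UNonzero⇒nonzero A (a , ≢0) = + a , ≢0 ∘ trans (ucoef-δ A a)

push-supported : ∀ {n} (H : Vec ℤ n → ℤ) e → push H e ≢ 0ℤ → 0ℤ ℤ.≤ e
push-supported H (+ d)    _   = ℤ.+≤+ z≤n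
push-supported H -[1+ d ] 0≢0 = contradiction refl 0≢0

usupported-ext : ∀ {H K : ℤ → ℤ} → (∀ e → H e ≢ 0ℤ → 0ℤ ℤ.≤ e) → (∀ e → K e ≢ 0ℤ → 0ℤ ℤ.≤ e) →
  (∀ a → H (+ a) ≡ K (+ a)) → ∀ e → H e ≡ K e
usupported-ext suppH suppK H≗K (+ a)    = H≗K a
usupported-ext {H} {K} suppH suppK H≗K -[1+ a ] =
  trans (vanishes (H -[1+ a ]) (suppH _) λ ()) (sym (vanishes (K -[1+ a ]) (suppK _) λ ()))

bounded-supported : ∀ {H : ℤ → ℤ} → (∀ e → H e ≢ 0ℤ → 0ℤ ℤ.≤ e) → U.Bounded H
bounded-supported {H} supp = 0ℤ , λ e → vanishes (H e) (supp e)

nonNeg-wt-0 : ∀ {n} {v : Vec ℤ n} → NonNeg v → wt v ≡ 0ℤ → v ≡ replicate n 0ℤ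
nonNeg-wt-0 []                           _  = refl
nonNeg-wt-0 (_∷_ {y = x} {ys = v} p ps) eq = cong₂ _∷_ x≡0 (nonNeg-wt-0 ps
  (trans (sym (ℤP.+-identityˡ (wt v))) (trans (cong (_+ wt v) (sym x≡0)) eq)))
  where
  x≡0 : x ≡ 0ℤ
  x≡0 = ℤP.≤-antisym (subst (x ℤ.≤_) eq (subst (ℤ._≤ x + wt v) (ℤP.+-identityʳ x)
    (ℤP.+-monoʳ-≤ x (wt-nonNeg ps)))) p

-- The origin is the only point of degree 0 in the orthant, so there H agrees with δ.
push-0 : ∀ {n} (H : Vec ℤ n → ℤ) → H (replicate n 0ℤ) ≡ 1ℤ → push H 0ℤ ≡ 1ℤ
push-0 {n} H H𝟘≡1 = trans (∑-cong-All (All.map agree (compositions-wt n 0ℤ))) (push-δ {n} 0ℤ)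
  where
  agree : ∀ {w} → wt (emb w) ≡ 0ℤ → H (emb w) ≡ V.δ n (emb w)
  agree {w} eq = trans (trans (cong H 𝟘≡) H𝟘≡1) (sym (ind-yes (replicate n 0ℤ ≟v emb w) (sym 𝟘≡)))
    where
    𝟘≡ : emb w ≡ replicate n 0ℤ
    𝟘≡ = nonNeg-wt-0 (emb-nonNeg w) eq

length-filter-∑ : {A : Set} {P : A → Set} (P? : ∀ x → Dec (P x)) (xs : List A) →
  + length (filter P? xs) ≡ ∑ xs (λ x → ind (P? x))
length-filter-∑ P? []       = refl
length-filter-∑ P? (x ∷ xs) with P? x
... | yes _ = cong (λ z → 1ℤ + z) (length-filter-∑ P? xs)
... | no _  = trans (length-filter-∑ P? xs) (sym (ℤP.+-identityˡ _))

-- Nonnegative sums, signs and interior points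

open import Data.List.Membership.Propositional using (_∈_)
open import Data.Nat using (_≤_; _<_)
open import Function.Bundles using (_⇔_; mk⇔)
∑-nonNeg : {A : Set} {f : A → ℤ} (xs : List A) → (∀ x → 0ℤ ℤ.≤ f x) → 0ℤ ℤ.≤ ∑ xs f
∑-nonNeg []       0≤f = ℤP.≤-refl
∑-nonNeg (x ∷ xs) 0≤f = ℤP.+-mono-≤ (0≤f x) (∑-nonNeg xs 0≤f)

nonNeg-+-≡0 : ∀ {a b} → 0ℤ ℤ.≤ a → 0ℤ ℤ.≤ b → a + b ≡ 0ℤ → a ≡ 0ℤ × b ≡ 0ℤ
nonNeg-+-≡0 {+ zero}  {b}   _ _ eq = refl , trans (sym (ℤP.+-identityˡ b)) eq
nonNeg-+-≡0 {+ suc a} {+ b} _ _ ()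

∑-nonNeg-≡0 : {A : Set} {f : A → ℤ} (xs : List A) → (∀ x → 0ℤ ℤ.≤ f x) → ∑ xs f ≡ 0ℤ → All (λ x → f x ≡ 0ℤ) xs
∑-nonNeg-≡0 []       0≤f _  = []
∑-nonNeg-≡0 (x ∷ xs) 0≤f eq with nonNeg-+-≡0 (0≤f x) (∑-nonNeg xs 0≤f) eq
... | fx≡0 , rest≡0 = fx≡0 ∷ ∑-nonNeg-≡0 xs 0≤f rest≡0

Sign-* : ∀ {σ ε} → Sign σ → Sign ε → Sign (σ * ε)
Sign-* (inj₁ refl) (inj₁ refl) = inj₁ refl
Sign-* (inj₁ refl) (inj₂ refl) = inj₂ refl
Sign-* (inj₂ refl) (inj₁ refl) = inj₂ refl
Sign-* (inj₂ refl) (inj₂ refl) = inj₁ refl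

Sign⇒≢0 : ∀ {σ} → Sign σ → σ ≢ 0ℤ
Sign⇒≢0 (inj₁ refl) ()
Sign⇒≢0 (inj₂ refl) ()

wt-surjective : ∀ {n} → 1 ℕ.≤ n → ∀ e → ∃ λ (v : Vec ℤ n) → wt v ≡ e
wt-surjective {suc n} _ e = e ∷ replicate n 0ℤ , trans (cong (λ z → e + z) (wt-𝟘 n)) (ℤP.+-identityʳ e)

interior⇒InL : ∀ s n l → InInterior s n l → InL s n l
interior⇒InL s n l l∈ zero    = ℤP.<⇒≤ (l∈ zero)
interior⇒InL s n l l∈ (suc j) = ℤP.<⇒≤ (l∈ (suc j))

interior+InL : ∀ s n c l → InInterior s n c → InL s n (λ i → l i - c i) → InInterior s n l
interior+InL s n c l c∈ l-c∈ zero =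
  ℤP.<-≤-trans (c∈ zero) (ℤP.0≤i-j⇒j≤i (l-c∈ zero))
interior+InL s n c l c∈ l-c∈ (suc j) = subst₂ ℤ._<_
  (collect (c (inject₁ j)) (l (inject₁ j)) (+ s (suc (suc (toℕ j))))) (collect (c (suc j)) (l (suc j)) (+ s (suc (toℕ j))))
  (ℤP.+-mono-<-≤ (c∈ (suc j)) (l-c∈ (suc j)))
  where
  collect : ∀ c l a → c * a + (l - c) * a ≡ l * a
  collect = solve-∀

tabulate-⊝ : ∀ {n} (l c : Fin n → ℤ) → tabulate (λ i → l i - c i) ≡ V._⊝_ n (tabulate l) (tabulate c)
tabulate-⊝ {zero}  l c = refl
tabulate-⊝ {suc n} l c = cong (λ z → l zero - c zero ∷ z) (tabulate-⊝ (l ∘ suc) (c ∘ suc))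

≡1-ext : ∀ {a b} → (a ≢ 0ℤ → b ≡ 1ℤ) → (b ≢ 0ℤ → a ≡ 1ℤ) → a ≡ b
≡1-ext {a} {b} f h with a ℤ.≟ 0ℤ | b ℤ.≟ 0ℤ
... | yes refl | yes refl = refl
... | yes refl | no b≢0   = contradiction (h b≢0) λ ()
... | no a≢0   | no b≢0   = trans (h b≢0) (sym (f a≢0))
... | no a≢0   | yes refl = contradiction (f a≢0) λ ()

-- Generating functions of the cone and its interior

module _ (s : ℕ → ℕ) {n : ℕ} where
  open V n

  g g° : Series
  g  = W [0≤] s 1 0ℤ
  g° = W [0<] s 1 0ℤ

  InL⇒g≡1 : ∀ l → InL s n l → g (tabulate l) ≡ 1ℤ
  InL⇒g≡1 l = chain⇒W≡1 (λ N y → ind-yes (0ℤ ℤ.≤? y)) s 1 0ℤ (tabulate l) ∘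
    steps⇒chain ℤP.i≤j⇒0≤j-i ℤP.0≤i-j⇒j≤i s n l

  g≢0⇒InL : ∀ l → g (tabulate l) ≢ 0ℤ → InL s n l
  g≢0⇒InL l = chain⇒steps ℤP.i≤j⇒0≤j-i ℤP.0≤i-j⇒j≤i s n l ∘
    W≢0⇒chain (λ N y → ind≢0⇒ (0ℤ ℤ.≤? y)) s 1 0ℤ (tabulate l)

  interior⇒g°≡1 : ∀ l → InInterior s n l → g° (tabulate l) ≡ 1ℤ
  interior⇒g°≡1 l = chain⇒W≡1 (λ N y → ind-yes (0ℤ ℤ.<? y)) s 1 0ℤ (tabulate l) ∘
    steps⇒chain i<j⇒0<j-i 0<j-i⇒i<j s n l

  g°≢0⇒interior : ∀ l → g° (tabulate l) ≢ 0ℤ → InInterior s n l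
  g°≢0⇒interior l = chain⇒steps i<j⇒0<j-i 0<j-i⇒i<j s n l ∘
    W≢0⇒chain (λ N y → ind≢0⇒ (0ℤ ℤ.<? y)) s 1 0ℤ (tabulate l)

  ind-g : ∀ l → ind (InL? s n l) ≡ g (tabulate l)
  ind-g l with InL? s n l
  ... | yes l∈L = sym (InL⇒g≡1 l l∈L)
  ... | no l∉L  = sym (vanishes (g (tabulate l)) (g≢0⇒InL l) l∉L)

  fcoef-push : ∀ d → fcoef s n d ≡ push g (+ d)
  fcoef-push d = trans (length-filter-∑ (λ v → InL? s n (toℤv v)) (comps n d))
    (∑-cong (comps n d) (λ w → ind-g (toℤv w)))

  -- The summand of Qgcoef is a local function of Defs; unification is the only way to name it.
  Qgcoef-summand : (Q : MPoly n) (a : Fin n → ℕ) → Σ ((Fin n → ℕ) × ℤ → ℤ) λ f → Qgcoef s n Q a ≡ ∑ Q f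
  Qgcoef-summand Q a = _ , refl

  Qfcoef-summand : (Q : UPoly) (a : ℕ) → Σ (ℕ × ℤ → ℤ) λ f → Qfcoef s n Q a ≡ ∑ Q f
  Qfcoef-summand Q a = _ , refl

  module _ (s>0 : Positive s) where

    g-supported : NonNegSupported {n} g
    g-supported = W-nonNeg s>0 [0≤]-nonNeg (s≤s z≤n) ℤP.≤-refl

    g°-supported : NonNegSupported {n} g°
    g°-supported = W-nonNeg s>0 [0<]-nonNeg (s≤s z≤n) ℤP.≤-refl

    summand-g : ∀ Q a x → proj₁ (Qgcoef-summand Q a) x ≡ proj₂ x * g (emb a ⊝ emb (proj₁ x))
    summand-g Q a (b , c) with PtLe? b a
    ... | yes b≤a = cong (c *_) (trans (ind-g _) (cong g (emb-∸ a b b≤a)))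
    -- The default value 0 in `Qgcoef` is right because g vanishes at an exponent with a negative
    -- entry.
    ... | no b≰a  = sym (trans (cong (c *_) (vanishes (g (emb a ⊝ emb b)) (nonNeg-⊝⇒≤ a b ∘ g-supported _) b≰a)) (ℤP.*-zeroʳ c))

    Qgcoef-· : ∀ Q a → Qgcoef s n Q a ≡ (lift Q · g) (emb a)
    Qgcoef-· Q a = trans (∑-cong Q (summand-g Q a)) (sym (∑-map _ (map₁ emb) Q))

    summand-f : ∀ Q a x → proj₁ (Qfcoef-summand Q a) x ≡ proj₂ x * push g (+ a - + proj₁ x)
    summand-f Q a (b , c) with b ℕ.≤? a
    ... | yes b≤a = cong (c *_) (trans (fcoef-push (a ℕ.∸ b)) (cong (push g)
                      (trans (sym (ℤP.⊖-≥ b≤a)) (sym (ℤP.m-n≡m⊖n a b)))))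
    ... | no b≰a  = sym (trans (cong (c *_) (vanishes (push g (+ a - + b))
                      (ℤP.drop‿+≤+ ∘ ℤP.0≤i-j⇒j≤i {+ a} {+ b} ∘ push-supported g _) b≰a)) (ℤP.*-zeroʳ c))

    Qfcoef-· : ∀ Q a → Qfcoef s n Q a ≡ (ulift Q U.· push g) (+ a)
    Qfcoef-· Q a = trans (∑-cong Q (summand-f Q a)) (sym (∑-map _ (map₁ pos) Q))

    RepG⇒· : ∀ P Q → RepG s n P Q → ∀ v → (lift Q · g) v ≡ (lift P · δ) v
    RepG⇒· P Q (_ , rep) = supported-ext (lift-supported Q g-supported) (lift-supported P δ-supported)
      (λ a → trans (sym (Qgcoef-· Q a)) (trans (rep a) (mcoef-δ P a)))

    ·⇒RepG : ∀ P Q → Nonzero (lift Q) → (∀ v → (lift Q · g) v ≡ (lift P · δ) v) → RepG s n P Q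
    ·⇒RepG P Q nz eq = nonzero⇒MNonzero Q nz ,
      λ a → trans (Qgcoef-· Q a) (trans (eq (emb a)) (sym (mcoef-δ P a)))

    RepF⇒· : ∀ P Q → RepF s n P Q → ∀ e → (ulift Q U.· push g) e ≡ (ulift P U.· U.δ) e
    RepF⇒· P Q (_ , rep) = usupported-ext (ulift-supported Q (push-supported g)) (ulift-supported P U-δ-supported)
      (λ a → trans (sym (Qfcoef-· Q a)) (trans (rep a) (ucoef-δ P a)))

    ·⇒RepF : ∀ P Q → U.Nonzero (ulift Q) → (∀ e → (ulift Q U.· push g) e ≡ (ulift P U.· U.δ) e) → RepF s n P Q
    ·⇒RepF P Q nz eq = nonzero⇒UNonzero Q nz ,
      λ a → trans (Qfcoef-· Q a) (trans (eq (+ a)) (sym (ucoef-δ P a)))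

    Q₀ : MPoly n
    Q₀ = denominator s n

    denominator-· : ∀ u v → (lift Q₀ · W u s 1 0ℤ) v ≡ W (Δ -1ℤ u) s 1 0ℤ v
    denominator-· u v = trans (∑-map _ (map₁ emb) Q₀) (trans
      (∑-cong Q₀ (λ { (b , c) → cong (λ z → c * W u s 1 0ℤ (v ⊕ z)) (VecP.map-cong (λ i → sym (ℤP.-1*i≡-i i)) (emb b)) }))
      (denominator-W u -1ℤ s n 1 0ℤ v))

    inv-denominator-· : ∀ u v → (inv (lift Q₀) · W u s 1 0ℤ) v ≡ W (Δ 1ℤ u) s 1 0ℤ v
    inv-denominator-· u v = trans (∑-map _ (map₁ ⊖_) (lift Q₀)) (trans (∑-map _ (map₁ emb) Q₀) (trans
      (∑-cong Q₀ (λ { (b , c) → cong (λ z → c * W u s 1 0ℤ (v ⊕ z)) (trans (sym (VecP.map-∘ neg neg (emb b)))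
        (VecP.map-cong (λ i → trans (ℤP.neg-involutive i) (sym (ℤP.*-identityˡ i))) (emb b))) }))
      (denominator-W u 1ℤ s n 1 0ℤ v)))

    numerator : (u : ℕ → ℤ → ℤ) → (∀ N y → Δ -1ℤ u N y ≢ 0ℤ → 0ℤ ℤ.≤ y × y ℤ.≤ + N) → MPoly n
    numerator u b = tabulated (W (Δ -1ℤ u) s 1 0ℤ) (proj₁ (W-bounded {Δ -1ℤ u} s>0 b {1} (s≤s z≤n) n 0))

    numerator-δ : ∀ u b v → (lift Q₀ · W u s 1 0ℤ) v ≡ (lift (numerator u b) · δ) v
    numerator-δ u b v = trans (denominator-· u v) (sym (tabulated-δ _
      (W-nonNeg s>0 (λ N y → proj₁ ∘ b N y) (s≤s z≤n) ℤP.≤-refl)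
      (proj₂ (W-bounded {Δ -1ℤ u} s>0 b {1} (s≤s z≤n) n 0) ℤP.≤-refl ℤP.≤-refl) v))

    P₀ P° : MPoly n
    P₀ = numerator [0≤] (Δ-bounded [0≤]-nonNeg [0≤]-one)
    P° = numerator [0<] (Δ-bounded [0<]-nonNeg [0<]-one)

    rational : ∀ v → (lift Q₀ · g) v ≡ (lift P₀ · δ) v
    rational = numerator-δ [0≤] _

    rational° : ∀ v → (lift Q₀ · g°) v ≡ (lift P° · δ) v
    rational° = numerator-δ [0<] _

    reciprocity : ∀ v → (inv (lift Q₀) · g°) v ≡ sgn n * (lift Q₀ · g) (⊖ v)
    reciprocity v = trans (inv-denominator-· [0<] v) (trans (W-reflect s 1 0ℤ v)
      (cong (sgn n *_) (sym (denominator-· [0≤] (⊖ v)))))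

    -- The origin lies in the half-open parallelepiped. This one value certifies that Q₀ is nonzero,
    -- and its specialization as well.
    Qg-𝟘 : (lift Q₀ · g) 𝟘 ≡ 1ℤ
    Qg-𝟘 = trans (denominator-· [0≤] 𝟘) (W-𝟘 one s>0 n (s≤s z≤n))
      where
      one : ∀ N → 0 ℕ.< N → Δ -1ℤ [0≤] N 0ℤ ≡ 1ℤ
      one (suc N) _ = refl

    Q₀-nonzero : Nonzero (lift Q₀)
    Q₀-nonzero = ·-nonzero (lift Q₀) g 𝟘 (λ eq → contradiction (trans (sym Qg-𝟘) eq) λ ())

    module Multivariate = Reciprocity g g° (lift Q₀) (lift P₀) (sgn n) (sgn² n) rational reciprocity

    -- Reciprocity for f

    F F° : U.Series
    F  = push g
    F° = push g°

    q p p° : U.Poly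
    q  = weigh (lift Q₀)
    p  = weigh (lift P₀)
    p° = weigh (lift P°)

    push-rational : ∀ H A → NonNegSupported {n} H → (∀ v → (lift Q₀ · H) v ≡ (lift A · δ) v) →
      ∀ e → (q U.· push H) e ≡ (weigh (lift A) U.· U.δ) e
    push-rational H A suppH eq e = trans (sym (push-· Q₀ suppH e)) (trans (push-cong eq e)
      (trans (push-· A δ-supported e) (U.·-cong (weigh (lift A)) (push-δ {n}) e)))

    F-rational : ∀ e → (q U.· F) e ≡ (p U.· U.δ) e
    F-rational = push-rational g P₀ (g-supported) (rational)

    F°-rational : ∀ e → (q U.· F°) e ≡ (p° U.· U.δ) e
    F°-rational = push-rational g° P° (g°-supported) (rational°)

    -- Specialization can kill a nonzero polynomial, so `Q₀-nonzero` does not suffice. In degree 0,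
    -- however, q F has the coefficient of Q₀ g at the origin, which is 1.
    q-nonzero : U.Nonzero q
    q-nonzero = U.·-nonzero q F 0ℤ λ eq → contradiction (trans (sym value) eq) λ ()
      where
      value : (q U.· F) 0ℤ ≡ 1ℤ
      value = trans (sym (push-· Q₀ (g-supported) 0ℤ)) (push-0 (lift Q₀ · g) (Qg-𝟘))

    -- For n ≥ 1 every degree e is some `wt v`, so the claim can be pulled back along `wt`. There
    -- both sides are actions of polynomials on `U.δ ∘ wt`, and `poly-ext` applies.
    F-numerator-reciprocity : 1 ℕ.≤ n →
      ∀ e → (q U.· U.inv p U.· U.δ) e ≡ sgn n * (U.inv q U.· p° U.· U.δ) e
    F-numerator-reciprocity 1≤n e with wt-surjective 1≤n e
    ... | v , refl = begin
      (q U.· U.inv p U.· U.δ) (wt v)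
        ≡⟨ cong (λ z → (q U.· z U.· U.δ) (wt v)) (weigh-inv (lift P₀)) ⟨
      (q U.· weigh (inv (lift P₀)) U.· U.δ) (wt v)
        ≡⟨ weigh-·-· (lift Q₀) (inv (lift P₀)) v ⟨
      (lift Q₀ · inv (lift P₀) · (U.δ ∘ wt)) v
        ≡⟨ ⊛-· (lift Q₀) (inv (lift P₀)) (U.δ ∘ wt) v ⟨
      ((lift Q₀ ⊛ inv (lift P₀)) · (U.δ ∘ wt)) v
        ≡⟨ poly-ext (lift Q₀ ⊛ inv (lift P₀)) (scale (sgn n) (inv (lift Q₀) ⊛ lift P°)) equal (U.δ ∘ wt) v ⟩
      (scale (sgn n) (inv (lift Q₀) ⊛ lift P°) · (U.δ ∘ wt)) v
        ≡⟨ scaled (U.δ ∘ wt) v ⟩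
      sgn n * (inv (lift Q₀) · lift P° · (U.δ ∘ wt)) v
        ≡⟨ cong (sgn n *_) (weigh-·-· (inv (lift Q₀)) (lift P°) v) ⟩
      sgn n * (weigh (inv (lift Q₀)) U.· p° U.· U.δ) (wt v)
        ≡⟨ cong (λ z → sgn n * (z U.· p° U.· U.δ) (wt v)) (weigh-inv (lift Q₀)) ⟩
      sgn n * (U.inv q U.· p° U.· U.δ) (wt v) ∎
      where
      open ≡-Reasoning
      scaled : ∀ H v → (scale (sgn n) (inv (lift Q₀) ⊛ lift P°) · H) v ≡ sgn n * (inv (lift Q₀) · lift P° · H) v
      scaled H v = trans (scale-· (sgn n) (inv (lift Q₀) ⊛ lift P°) H v)
        (cong (sgn n *_) (⊛-· (inv (lift Q₀)) (lift P°) H v))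
      equal : ∀ v → ((lift Q₀ ⊛ inv (lift P₀)) · δ) v ≡ (scale (sgn n) (inv (lift Q₀) ⊛ lift P°) · δ) v
      equal v = trans (⊛-· (lift Q₀) (inv (lift P₀)) δ v)
        (trans (Multivariate.numerator-reciprocity (lift P°) (rational°) v) (sym (scaled δ v)))

    -- Bi-infinite series cannot be summed along the degree, so the reciprocity law is pushed forward
    -- as an identity between Laurent polynomials and then divided by q.
    F-reciprocity : 1 ℕ.≤ n → ∀ e → (U.inv q U.· F°) e ≡ sgn n * (q U.· F) (- e)
    F-reciprocity 1≤n e = begin
      (U.inv q U.· F°) e                        ≡⟨ ℤP.*-identityˡ _ ⟨
      1ℤ * (U.inv q U.· F°) e                   ≡⟨ cong (_* (U.inv q U.· F°) e) (sgn² n) ⟨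
      sgn n * sgn n * (U.inv q U.· F°) e        ≡⟨ ℤP.*-assoc (sgn n) (sgn n) _ ⟩
      sgn n * (sgn n * (U.inv q U.· F°) e)      ≡⟨ cong (sgn n *_) (cancelled e) ⟨
      sgn n * (U.inv p U.· U.δ) e               ≡⟨ cong (sgn n *_) (trans (U.inv-δ p e) (sym (F-rational (- e)))) ⟩
      sgn n * (q U.· F) (- e)                   ∎
      where
      open ≡-Reasoning
      bF : U.Bounded (U.inv q U.· F°)
      bF = U.bounded-· (U.inv q) (bounded-supported (push-supported g°))
      cancelled : ∀ e → (U.inv p U.· U.δ) e ≡ sgn n * (U.inv q U.· F°) e
      cancelled = U.cancel q q-nonzero
        (U.bounded-· (U.inv p) (bounded-supported U-δ-supported))
        (proj₁ bF , λ e out → trans (cong (sgn n *_) (proj₂ bF e out)) (ℤP.*-zeroʳ (sgn n)))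
        λ e → begin
          (q U.· U.inv p U.· U.δ) e                          ≡⟨ F-numerator-reciprocity 1≤n e ⟩
          sgn n * (U.inv q U.· p° U.· U.δ) e                 ≡⟨ cong (sgn n *_) (U.·-cong (U.inv q) F°-rational e) ⟨
          sgn n * (U.inv q U.· q U.· F°) e                   ≡⟨ cong (sgn n *_) (U.·-comm (U.inv q) q F° e) ⟩
          sgn n * (q U.· U.inv q U.· F°) e                   ≡⟨ U.·-*ˡ q (sgn n) (U.inv q U.· F°) e ⟨
          (q U.· (λ x → sgn n * (U.inv q U.· F°) x)) e       ∎

    module Univariate (1≤n : 1 ℕ.≤ n) =
      U.Reciprocity F F° q p (sgn n) (sgn² n) F-rational (F-reciprocity 1≤n)

    -- Gorenstein points and translates

    g-𝟘 : g 𝟘 ≡ 1ℤ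
    g-𝟘 = W-𝟘 (λ _ _ → refl) s>0 n (s≤s z≤n)

    -- Both series are indicators, so comparing supports suffices. At v = c the right-hand side is κ
    -- g(0) = κ, which puts c in the interior.
    translate⇒Gorenstein : ∀ c κ → κ ≢ 0ℤ → (∀ v → g° v ≡ κ * g (v ⊝ tabulate c)) → Gorenstein s n
    translate⇒Gorenstein c κ κ≢0 G°≡ = c , c∈ , λ l → to l , from l
      where
      G°-nonzero : ∀ l → g (tabulate l ⊝ tabulate c) ≡ 1ℤ → InInterior s n l
      G°-nonzero l eq = g°≢0⇒interior l (κ≢0 ∘ trans (sym (trans (G°≡ (tabulate l))
        (trans (cong (κ *_) eq) (ℤP.*-identityʳ κ)))))
      c∈ : InInterior s n c
      c∈ = G°-nonzero c (trans (cong g (sym (≡⇒⊝≡𝟘 {tabulate c} refl))) g-𝟘)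
      to : ∀ l → InInterior s n l → InL s n (λ i → l i - c i)
      to l l∈ = g≢0⇒InL _ λ G≡0 → contradiction (trans (sym (interior⇒g°≡1 l l∈)) (trans (G°≡ (tabulate l))
        (trans (cong (κ *_) (trans (cong g (sym (tabulate-⊝ l c))) G≡0)) (ℤP.*-zeroʳ κ)))) λ ()
      from : ∀ l → InL s n (λ i → l i - c i) → InInterior s n l
      from l l-c∈ = G°-nonzero l (trans (cong g (sym (tabulate-⊝ l c))) (InL⇒g≡1 _ l-c∈))

    Gorenstein⇒translate : ((c , _) : Gorenstein s n) → ∀ v → g° v ≡ g (v ⊝ tabulate c)
    Gorenstein⇒translate (c , c∈ , gor) v = begin
      g° v                              ≡⟨ cong g° (VecP.tabulate∘lookup v) ⟨
      g° (tabulate l)                   ≡⟨ ≡1-ext (InL⇒g≡1 _ ∘ proj₁ (gor l) ∘ g°≢0⇒interior l)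
                                             (interior⇒g°≡1 l ∘ proj₂ (gor l) ∘ g≢0⇒InL _) ⟩
      g (tabulate (λ i → l i - c i))    ≡⟨ cong g (tabulate-⊝ l c) ⟩
      g (tabulate l ⊝ tabulate c)       ≡⟨ cong (λ z → g (z ⊝ tabulate c)) (VecP.tabulate∘lookup v) ⟩
      g (v ⊝ tabulate c)                ∎
      where
      open ≡-Reasoning
      l : Fin n → ℤ
      l = lookup v

    g°∈01 : ∀ v → g° v ≢ 0ℤ → g° v ≡ 1ℤ
    g°∈01 v = chain⇒W≡1 (λ N y → ind-yes (0ℤ ℤ.<? y)) s 1 0ℤ v ∘ W≢0⇒chain (λ N y → ind≢0⇒ (0ℤ ℤ.<? y)) s 1 0ℤ v

    0≤g° : ∀ v → 0ℤ ℤ.≤ g° v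
    0≤g° v with g° v ℤ.≟ 0ℤ
    ... | yes eq  = ℤP.≤-reflexive (sym eq)
    ... | no g°≢0 = ℤP.≤-trans (ℤ.+≤+ z≤n) (ℤP.≤-reflexive (sym (g°∈01 v g°≢0)))

    -- The inclusion of c + L in the interior in numerical form: a vanishing sum of these
    -- differences over one degree forces each of them to vanish.
    interior-translate : ∀ c → InInterior s n c → ∀ v → 0ℤ ℤ.≤ g° v - g (v ⊝ tabulate c)
    interior-translate c c∈ v with g (v ⊝ tabulate c) ℤ.≟ 0ℤ
    ... | yes g≡0 = subst (λ z → 0ℤ ℤ.≤ g° v - z) (sym g≡0) (subst (0ℤ ℤ.≤_) (sym (ℤP.+-identityʳ (g° v))) (0≤g° v))
    ... | no g≢0  = ℤP.≤-reflexive (sym (ℤP.i≡j⇒i-j≡0 (trans g°≡1 (sym g≡1))))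
      where
      l : Fin n → ℤ
      l = lookup v
      shape : tabulate (λ i → l i - c i) ≡ v ⊝ tabulate c
      shape = trans (tabulate-⊝ l c) (cong (_⊝ tabulate c) (VecP.tabulate∘lookup v))
      l-c∈ : InL s n (λ i → l i - c i)
      l-c∈ = g≢0⇒InL _ (g≢0 ∘ trans (cong g (sym shape)))
      g≡1 : g (v ⊝ tabulate c) ≡ 1ℤ
      g≡1 = trans (cong g (sym shape)) (InL⇒g≡1 _ l-c∈)
      g°≡1 : g° v ≡ 1ℤ
      g°≡1 = trans (cong g° (sym (VecP.tabulate∘lookup v))) (interior⇒g°≡1 l (interior+InL s n c l c∈ l-c∈))

    -- c + L lies in the interior, so equality of the weighted counts forces equality of the sets.
    F-translate⇒Gorenstein : ∀ k {κ} → Sign κ → (∀ e → F° e ≡ κ * F (e - + k)) → Gorenstein s n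
    F-translate⇒Gorenstein k {κ} sκ F°≡ = conclude (∑≢0 (compositions n (+ k)) (Sign⇒≢0 sκ ∘ trans (sym F°k)))
      where
      -- F has constant term 1, so F° is nonzero in degree k; an interior point of that degree is
      -- the candidate for c.
      F°k : F° (+ k) ≡ κ
      F°k = trans (F°≡ (+ k)) (trans (cong (λ z → κ * F z) (ℤP.+-inverseʳ (+ k)))
        (trans (cong (κ *_) (push-0 g g-𝟘)) (ℤP.*-identityʳ κ)))
      -- F° counts points, which excludes the sign -1.
      κ≡1 : κ ≡ 1ℤ
      κ≡1 = nonNeg-Sign sκ (subst (0ℤ ℤ.≤_) F°k (∑-nonNeg (compositions n (+ k)) (0≤g° ∘ emb)))
        where
        nonNeg-Sign : ∀ {κ} → Sign κ → 0ℤ ℤ.≤ κ → κ ≡ 1ℤ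
        nonNeg-Sign (inj₁ eq)   _ = eq
        nonNeg-Sign (inj₂ refl) ()
      conclude : (∃ λ b → b ∈ compositions n (+ k) × g° (emb b) ≢ 0ℤ) → Gorenstein s n
      conclude (b , b∈ , g°b≢0) = translate⇒Gorenstein (toℤv b) 1ℤ (λ ())
        (λ v → trans (supported-ext g°-supported shift-supported on-ℕ v) (sym (ℤP.*-identityˡ _)))
        where
        shift-supported : NonNegSupported {n} (λ v → g (v ⊝ emb b))
        shift-supported v ≢0 = nonNeg-⊝ v b (g-supported (v ⊝ emb b) ≢0)
        c∈ : InInterior s n (toℤv b)
        c∈ = g°≢0⇒interior (toℤv b) g°b≢0
        push-difference : ∀ e → push (λ v → g° v - g (v ⊝ emb b)) e ≡ 0ℤ
        push-difference e = begin
          push (λ v → g° v - g (v ⊝ emb b)) e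
            ≡⟨ ∑-distrib-+ (g° ∘ emb) (λ w → - g (emb w ⊝ emb b)) (compositions n e) ⟩
          F° e + ∑ (compositions n e) (λ w → - g (emb w ⊝ emb b))
            ≡⟨ cong (λ z → F° e + z) (trans (∑-cong (compositions n e) (λ w → sym (ℤP.-1*i≡-i (g (emb w ⊝ emb b)))))
                 (trans (*-distribˡ-∑ -1ℤ (λ w → g (emb w ⊝ emb b)) (compositions n e)) (ℤP.-1*i≡-i _))) ⟩
          F° e - push (λ v → g (v ⊝ emb b)) e
            ≡⟨ cong (λ z → F° e - z) (trans (push-shift g-supported b e)
                 (cong (λ z → F (e - z)) (All.lookup (compositions-wt n (+ k)) b∈))) ⟩
          F° e - F (e - + k)
            ≡⟨ ℤP.i≡j⇒i-j≡0 (trans (F°≡ e) (trans (cong (_* F (e - + k)) κ≡1) (ℤP.*-identityˡ _))) ⟩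
          0ℤ ∎
          where open ≡-Reasoning
        on-ℕ : ∀ a → g° (emb a) ≡ g (emb a ⊝ emb b)
        -- Functions that agree pointwise need not be equal, so instead of `a` itself a listed `w`
        -- with `emb a ≡ emb w` is used; the nonzero count provides it.
        on-ℕ a with ∑≢0 (compositions n (wt (emb a))) (λ eq → contradiction
          (trans (sym (trans (compositions-count (emb-nonNeg a) (wt (emb a))) (ind-yes (wt (emb a) ℤ.≟ wt (emb a)) refl))) eq) λ ())
        ... | w , w∈ , ind≢0 = trans (cong g° a≡w) (trans
            (ℤP.i-j≡0⇒i≡j (g° (emb w)) (g (emb w ⊝ emb b)) (All.lookup (∑-nonNeg-≡0 (compositions n (wt (emb a)))
              (interior-translate (toℤv b) c∈ ∘ emb) (push-difference (wt (emb a)))) w∈))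
            (cong (λ z → g (z ⊝ emb b)) (sym a≡w)))
          where
          a≡w : emb a ≡ emb w
          a≡w = ind≢0⇒ (emb a ≟v emb w) ind≢0

    -- The implications between the three conditions

    Gorenstein⇒CondII : Gorenstein s n → CondII s n
    Gorenstein⇒CondII gor@(c , c∈ , _) =
      c , interior⇒InL s n c c∈ , P₀ , Q₀ , ·⇒RepG P₀ Q₀ Q₀-nonzero rational , sgn n , sgn-Sign n , λ e → begin
        laurCoef zeroV P₀ Q₀ e
          ≡⟨ laurCoef-laur zeroV P₀ Q₀ e ⟩
        laur (tabulate zeroV) (lift P₀) (lift Q₀) (tabulate e)
          ≡⟨ cong (λ z → laur z (lift P₀) (lift Q₀) (tabulate e)) (sym (emb-0 n)) ⟩
        laur 𝟘 (lift P₀) (lift Q₀) (tabulate e)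
          ≡⟨ Multivariate.translate⇒functional-equation (tabulate c) (Gorenstein⇒translate gor) (tabulate e) ⟩
        sgn n * laur (tabulate c) (lift Q₀) (lift P₀) (tabulate e)
          ≡⟨ cong (sgn n *_) (laurCoef-laur c Q₀ P₀ e) ⟨
        sgn n * laurCoef c Q₀ P₀ e ∎
      where open ≡-Reasoning

    CondII⇒Gorenstein : CondII s n → Gorenstein s n
    CondII⇒Gorenstein (m , _ , P , Q , rep , ε , sε , fe) =
      translate⇒Gorenstein m (sgn n * ε) (Sign⇒≢0 (Sign-* (sgn-Sign n) sε))
        (Multivariate.functional-equation⇒translate (bounded-nonNeg g-supported) (bounded-nonNeg g°-supported)
          Q₀-nonzero (lift P) (lift Q) (MNonzero⇒nonzero Q (proj₁ rep)) (RepG⇒· P Q rep) ε (tabulate m) fe′)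
      where
      open ≡-Reasoning
      fe′ : ∀ v → laur 𝟘 (lift P) (lift Q) v ≡ ε * laur (tabulate m) (lift Q) (lift P) v
      fe′ v = begin
        laur 𝟘 (lift P) (lift Q) v
          ≡⟨ cong₂ (λ y z → laur y (lift P) (lift Q) z) (emb-0 n) (sym (VecP.tabulate∘lookup v)) ⟩
        laur (tabulate zeroV) (lift P) (lift Q) (tabulate (lookup v))
          ≡⟨ laurCoef-laur zeroV P Q (lookup v) ⟨
        laurCoef zeroV P Q (lookup v)
          ≡⟨ fe (lookup v) ⟩
        ε * laurCoef m Q P (lookup v)
          ≡⟨ cong (ε *_) (trans (laurCoef-laur m Q P (lookup v))
               (cong (laur (tabulate m) (lift Q) (lift P)) (VecP.tabulate∘lookup v))) ⟩
        ε * laur (tabulate m) (lift Q) (lift P) v ∎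

    Gorenstein⇒CondIII : 1 ℕ.≤ n → Gorenstein s n → CondIII s n
    -- Interior points lie in the orthant, so c has natural coordinates; `push-shift` applies to it,
    -- and its degree is the natural number k.
    Gorenstein⇒CondIII 1≤n gor@(c , c∈ , _) = conclude (nonNeg-emb (g°-supported (tabulate c)
        λ eq → contradiction (trans (sym (interior⇒g°≡1 c c∈)) eq) λ ()))
      where
      open ≡-Reasoning
      uP uQ : UPoly
      uP = total-degree P₀
      uQ = total-degree Q₀
      uP≡ : ulift uP ≡ p
      uP≡ = ulift-total-degree P₀
      uQ≡ : ulift uQ ≡ q
      uQ≡ = ulift-total-degree Q₀
      F-shift : ∀ b → tabulate c ≡ emb b → ∀ e → F° e ≡ F (e - + ∣wt∣ b)
      F-shift b c≡b e = begin
        F° e                                 ≡⟨ push-cong (Gorenstein⇒translate gor) e ⟩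
        push (λ v → g (v ⊝ tabulate c)) e    ≡⟨ push-cong (λ v → cong (λ z → g (v ⊝ z)) c≡b) e ⟩
        push (λ v → g (v ⊝ emb b)) e         ≡⟨ push-shift g-supported b e ⟩
        F (e - wt (emb b))                   ≡⟨ cong (λ z → F (e - z)) (ℤP.0≤i⇒+∣i∣≡i (wt-nonNeg (emb-nonNeg b))) ⟨
        F (e - + ∣wt∣ b)                     ∎
      conclude : (∃ λ b → tabulate c ≡ emb b) → CondIII s n
      conclude (b , c≡b) = uP , uQ ,
        ·⇒RepF uP uQ (subst U.Nonzero (sym uQ≡) q-nonzero)
          (λ e → subst₂ (λ y z → (y U.· F) e ≡ (z U.· U.δ) e) (sym uQ≡) (sym uP≡) (F-rational e)) ,
        ∣wt∣ b , sgn n , sgn-Sign n , λ e → begin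
          ulaurCoef 0ℤ uP uQ e
            ≡⟨ ulaurCoef-laur 0ℤ uP uQ e ⟩
          U.laur 0ℤ (ulift uP) (ulift uQ) e
            ≡⟨ cong₂ (λ y z → U.laur 0ℤ y z e) uP≡ uQ≡ ⟩
          U.laur 0ℤ p q e
            ≡⟨ Univariate.translate⇒functional-equation 1≤n (+ ∣wt∣ b) (F-shift b c≡b) e ⟩
          sgn n * U.laur (+ ∣wt∣ b) q p e
            ≡⟨ cong (sgn n *_) (trans (cong₂ (λ y z → U.laur (+ ∣wt∣ b) y z e) (sym uQ≡) (sym uP≡))
                 (sym (ulaurCoef-laur (+ ∣wt∣ b) uQ uP e))) ⟩
          sgn n * ulaurCoef (+ ∣wt∣ b) uQ uP e ∎

    CondIII⇒Gorenstein : 1 ℕ.≤ n → CondIII s n → Gorenstein s n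
    CondIII⇒Gorenstein 1≤n (P , Q , rep , k , ε , sε , fe) =
      F-translate⇒Gorenstein k (Sign-* (sgn-Sign n) sε)
        (Univariate.functional-equation⇒translate 1≤n
          (bounded-supported (push-supported g)) (bounded-supported (push-supported g°))
          q-nonzero (ulift P) (ulift Q) (UNonzero⇒nonzero Q (proj₁ rep)) (RepF⇒· P Q rep) ε (+ k)
          λ e → trans (sym (ulaurCoef-laur 0ℤ P Q e)) (trans (fe e) (cong (ε *_) (ulaurCoef-laur (+ k) Q P e))))

theorem1p5 : (s : ℕ → ℕ) → (∀ i → 1 ≤ i → 0 < s i) →
    (n : ℕ) → 1 ≤ n →
    (Gorenstein s n ⇔ CondII s n) × (CondII s n ⇔ CondIII s n)
theorem1p5 s s>0 n 1≤n =
  mk⇔ (Gorenstein⇒CondII s s>0) (CondII⇒Gorenstein s s>0) ,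
  mk⇔ (Gorenstein⇒CondIII s s>0 1≤n ∘ CondII⇒Gorenstein s s>0)
      (Gorenstein⇒CondII s s>0 ∘ CondIII⇒Gorenstein s s>0 1≤n)
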